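{- Let $Q$ be a torsion-free fs monoid and let $P$ be a toric submonoid of $Q$ such that $Q\cap(-P)=\{0\}$ (inside $Q^{\mathrm{gp}}$). Then the inclusion $u: P\hookrightarrow Q$ is pseudo-saturated if and only if every $y\in Q_{\mathbb Q_{\ge0}}$ admits a unique minimal decomposition relative to $(P,Q)$.
   Context: All monoids are commutative with identity, written additively. $P^{\mathrm{gp}}$ is the group envelope of $P$. $P$ is integral if $P\to P^{\mathrm{gp}}$ is injective; saturated if it is integral and every $a\in P^{\mathrm{gp}}$ with $na\in P$ for some integer $n\ge1$ lies in $P$; fs if it is saturated and finitely generated; sharp if its only unit is $0$; toric if it is sharp and fs. For $x,x'$ in a monoid $P$, write $x\mid x'$ if $x'=x+x''$ for some $x''\in P$. For a saturated torsion-free monoid $P$ let $P_{\mathbb Q_{\ge0}}=\varinjlim_n \frac1n P$ (colimit over positive integers, ordered by divisibility), viewed inside $P^{\mathrm{gp}}\otimes_{\mathbb Z}\mathbb Q$. A homomorphism $u:P\to Q$ of saturated monoids is pseudo-saturated if there is an integer $M\ge1$ such that for every integer $n\ge1$ and all $x\in P$, $y\in Q$ with $u(x)\mid ny$ in $Q$, there exists $x'\in P$ with $Mx\mid nx'$ in $P$ and $u(x')\mid My$ in $Q$. Minimal decomposition: for $P\subset Q$ as in the claim and $y\in Q_{\mathbb Q_{\ge0}}$, a decomposition $y=y'+x'$ with $y'\in Q_{\mathbb Q_{\ge0}}$ and $x'\in P_{\mathbb Q_{\ge0}}$ is a minimal decomposition of $y$ relative to $(P,Q)$ if for every $x\in P_{\mathbb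 Q_{\ge0}}\setminus\{0\}$ one has $y'-x\notin Q_{\mathbb Q_{\ge0}}$. -}

module Defs where

open import Level using (Level; _⊔_; suc)
open import Algebra.Bundles using (CommutativeMonoid; RawMonoid; AbelianGroup)
open import Algebra.Definitions.RawMagma using (_∣ˡ_)
open import Algebra.Morphism.Bundles using (MonoidHomomorphism)
open import Algebra.Morphism.Structures using (IsMonoidMonomorphism)
import Algebra.Morphism.MonoidMonomorphism as MonoidMonomorphism
import Algebra.Properties.AbelianGroup as AbelianGroupProperties
import Algebra.Properties.CommutativeMonoid.Mult as CommutativeMonoidMult
import Algebra.Properties.CommutativeSemigroup as CommutativeSemigroupProperties
import Algebra.Properties.Monoid.Sum as MonoidSum
import Algebra.Solver.CommutativeMonoid as CommutativeMonoidSolver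
open import Data.Fin.Base using (Fin)
open import Data.Nat.Base as ℕ using (ℕ; NonZero)
import Data.Nat.Properties as ℕₚ
open import Data.Nat.Solver using (module +-*-Solver)
open import Data.Product.Base using (Σ; ∃; ∃-syntax; _×_; _,_; proj₁; proj₂)
open import Function.Definitions using (Injective)
open import Relation.Binary.Bundles using (Setoid)
open import Relation.Binary.PropositionalEquality as ≡ using (_≡_)
import Relation.Binary.Reasoning.Setoid as SetoidReasoning
open import Relation.Nullary.Negation.Core using (¬_)
open import Relation.Unary using (Pred; _∈_; _∉_)

private
  variable
    a b c ℓ p : Level

Image : {A : Set a} (S : Setoid b ℓ) → (A → Setoid.Carrier S) →
        Pred (Setoid.Carrier S) (a ⊔ ℓ)
Image {A = A} S f y = ∃[ x ] f x ≈ y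
  where open Setoid S

module GroupEnvelope (M : CommutativeMonoid c ℓ) where

  open CommutativeMonoid M
    renaming (_∙_ to _+_; ε to 0#; ∙-cong to +-cong; ∙-congʳ to +-congʳ)
  open CommutativeMonoidSolver M using (solve; _⊜_; _⊕_; id)
  open SetoidReasoning setoid

  infix 6 _⊖_
  infix 4 _≈ᵍᵖ_

  -- a ⊖ b stands for ι a - ι b.
  record Difference : Set c where
    constructor _⊖_
    field
      pos neg : Carrier

  open Difference public

  record _≈ᵍᵖ_ (x y : Difference) : Set (c ⊔ ℓ) where
    constructor witness
    field
      slack    : Carrier
      equality : (pos x + neg y) + slack ≈ (pos y + neg x) + slack

  _+ᵍᵖ_ : Difference → Difference → Difference
  (a ⊖ b) +ᵍᵖ (c ⊖ d) = (a + c) ⊖ (b + d)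

  -ᵍᵖ_ : Difference → Difference
  -ᵍᵖ (a ⊖ b) = b ⊖ a

  0ᵍᵖ : Difference
  0ᵍᵖ = 0# ⊖ 0#

  private
    trans-≈ᵍᵖ : ∀ {x y z} → x ≈ᵍᵖ y → y ≈ᵍᵖ z → x ≈ᵍᵖ z
    trans-≈ᵍᵖ {a ⊖ b} {c ⊖ d} {e ⊖ f} (witness k p) (witness l q) =
      witness ((c + d) + (k + l)) (begin
        (a + f) + ((c + d) + (k + l))
          ≈⟨ solve 6 (λ a f c d k l →
               (a ⊕ f) ⊕ ((c ⊕ d) ⊕ (k ⊕ l)) ⊜
               ((a ⊕ d) ⊕ k) ⊕ ((c ⊕ f) ⊕ l)) refl a f c d k l ⟩
        ((a + d) + k) + ((c + f) + l)
          ≈⟨ +-cong p q ⟩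
        ((c + b) + k) + ((e + d) + l)
          ≈⟨ solve 6 (λ e b c d k l →
               ((c ⊕ b) ⊕ k) ⊕ ((e ⊕ d) ⊕ l) ⊜
               (e ⊕ b) ⊕ ((c ⊕ d) ⊕ (k ⊕ l))) refl e b c d k l ⟩
        (e + b) + ((c + d) + (k + l)) ∎)

    cong-+ᵍᵖ : ∀ {x y u v} → x ≈ᵍᵖ y → u ≈ᵍᵖ v → (x +ᵍᵖ u) ≈ᵍᵖ (y +ᵍᵖ v)
    cong-+ᵍᵖ {a ⊖ b} {c ⊖ d} {e ⊖ f} {g ⊖ h} (witness k p) (witness l q) =
      witness (k + l) (begin
        ((a + e) + (d + h)) + (k + l)
          ≈⟨ regroup a e d h k l ⟩
        ((a + d) + k) + ((e + h) + l)
          ≈⟨ +-cong p q ⟩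
        ((c + b) + k) + ((g + f) + l)
          ≈⟨ regroup c g b f k l ⟨
        ((c + g) + (b + f)) + (k + l) ∎)
      where
      regroup : ∀ a e d h k l →
                ((a + e) + (d + h)) + (k + l) ≈ ((a + d) + k) + ((e + h) + l)
      regroup = solve 6 (λ a e d h k l →
        ((a ⊕ e) ⊕ (d ⊕ h)) ⊕ (k ⊕ l) ⊜ ((a ⊕ d) ⊕ k) ⊕ ((e ⊕ h) ⊕ l)) refl

    neg-cong : ∀ {x y} → x ≈ᵍᵖ y → (-ᵍᵖ x) ≈ᵍᵖ (-ᵍᵖ y)
    neg-cong {a ⊖ b} {c ⊖ d} (witness k p) = witness k
      (trans (+-congʳ (comm b c)) (trans (sym p) (+-congʳ (comm a d))))

  groupEnvelope : AbelianGroup c (c ⊔ ℓ)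
  groupEnvelope = record
    { Carrier = Difference
    ; _≈_ = _≈ᵍᵖ_
    ; _∙_ = _+ᵍᵖ_
    ; ε = 0ᵍᵖ
    ; _⁻¹ = -ᵍᵖ_
    ; isAbelianGroup = record
      { isGroup = record
        { isMonoid = record
          { isSemigroup = record
            { isMagma = record
              { isEquivalence = record
                { refl = witness 0# refl
                ; sym = λ (witness k p) → witness k (sym p)
                ; trans = trans-≈ᵍᵖ
                }
              ; ∙-cong = cong-+ᵍᵖ
              }
            ; assoc = λ (a ⊖ b) (c ⊖ d) (e ⊖ f) → witness 0#
                (solve 6 (λ a b c d e f →
                  (((a ⊕ c) ⊕ e) ⊕ (b ⊕ (d ⊕ f))) ⊕ id ⊜
                  ((a ⊕ (c ⊕ e)) ⊕ ((b ⊕ d) ⊕ f)) ⊕ id) refl a b c d e f)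
            }
          ; identity =
              (λ (a ⊖ b) → witness 0#
                (solve 2 (λ a b →
                  ((id ⊕ a) ⊕ b) ⊕ id ⊜ (a ⊕ (id ⊕ b)) ⊕ id) refl a b))
            , (λ (a ⊖ b) → witness 0#
                (solve 2 (λ a b →
                  ((a ⊕ id) ⊕ b) ⊕ id ⊜ (a ⊕ (b ⊕ id)) ⊕ id) refl a b))
          }
        ; inverse =
            (λ (a ⊖ b) → witness 0#
              (solve 2 (λ a b →
                ((b ⊕ a) ⊕ id) ⊕ id ⊜ (id ⊕ (a ⊕ b)) ⊕ id) refl a b))
          , (λ (a ⊖ b) → witness 0#
              (solve 2 (λ a b →
                ((a ⊕ b) ⊕ id) ⊕ id ⊜ (id ⊕ (b ⊕ a)) ⊕ id) refl a b))
        ; ⁻¹-cong = neg-cong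
        }
      ; comm = λ (a ⊖ b) (c ⊖ d) → witness 0#
          (solve 4 (λ a b c d →
            ((a ⊕ c) ⊕ (d ⊕ b)) ⊕ id ⊜ ((c ⊕ a) ⊕ (b ⊕ d)) ⊕ id) refl a b c d)
      }
    }

  ι : Carrier → Difference
  ι x = x ⊖ 0#

infix 8 _ᵍᵖ

_ᵍᵖ : CommutativeMonoid c ℓ → AbelianGroup c (c ⊔ ℓ)
M ᵍᵖ = GroupEnvelope.groupEnvelope M

infix 7 _/_

-- x / n is the element x of the n-th term (1/n) M of the system of copies of M
-- indexed by n ≥ 1, ordered by divisibility, whose colimit is taken below.
record Fraction (A : Set a) : Set a where
  constructor _/_
  field
    num         : A
    den         : ℕ
    .{{den≢0}}  : NonZero den

mapFraction : {A : Set a} {B : Set b} → (A → B) → Fraction A → Fraction B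
mapFraction f (x / n) = f x / n

module Colimit (M : CommutativeMonoid c ℓ) where

  open CommutativeMonoid M
    renaming ( _∙_ to _+_; ε to 0#; ∙-cong to +-cong; ∙-congʳ to +-congʳ
             ; ∙-congˡ to +-congˡ)
  open CommutativeMonoidMult M renaming (_×_ to _·_)
  open CommutativeSemigroupProperties commutativeSemigroup using (xy∙z≈xz∙y)
  open Fraction public
  open SetoidReasoning setoid

  infix 4 _≃_

  -- The transition map from the n-th to the (i * n)-th copy of M is
  -- multiplication by i; two elements agree in the colimit when their images
  -- agree in a common later copy.
  record _≃_ (x y : Fraction Carrier) : Set ℓ where
    constructor witness
    field
      i j         : ℕ
      .{{i≢0}}    : NonZero i
      .{{j≢0}}    : NonZero j
      same-index  : i ℕ.* den x ≡ j ℕ.* den y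
      same-image  : i · num x ≈ j · num y

  _+ℚ_ : Fraction Carrier → Fraction Carrier → Fraction Carrier
  (x / m) +ℚ (y / n) =
    _/_ (n · x + m · y) (m ℕ.* n) {{ℕₚ.m*n≢0 m n}}

  0ℚ : Fraction Carrier
  0ℚ = 0# / 1

  private
    ·-·-comm : ∀ m n x → m · (n · x) ≈ n · (m · x)
    ·-·-comm m n x = begin
      m · (n · x)     ≈⟨ ×-assocˡ x m n ⟩
      (m ℕ.* n) · x   ≈⟨ ×-congˡ (ℕₚ.*-comm m n) ⟩
      (n ℕ.* m) · x   ≈⟨ ×-assocˡ x n m ⟨
      n · (m · x)     ∎

    ·-0# : ∀ n → n · 0# ≈ 0#
    ·-0# ℕ.zero    = refl
    ·-0# (ℕ.suc n) = trans (identityˡ _) (·-0# n)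

    same-den : ∀ {x y m n} .{{_ : NonZero m}} .{{_ : NonZero n}} →
               x ≈ y → m ≡ n → (x / m) ≃ (y / n)
    same-den x≈y m≡n = witness 1 1 (≡.cong (1 ℕ.*_) m≡n) (×-congʳ 1 x≈y)

    trans-≃ : ∀ {x y z} → x ≃ y → y ≃ z → x ≃ z
    trans-≃ {x / m} {y / n} {z / o} (witness i j p q) (witness k l r s) =
      witness (k ℕ.* i) (j ℕ.* l)
        {{ℕₚ.m*n≢0 k i}} {{ℕₚ.m*n≢0 j l}}
        (≡.trans (ℕₚ.*-assoc k i m)
        (≡.trans (≡.cong (k ℕ.*_) p)
        (≡.trans (solve 3 (λ k j n → k :* (j :* n) := j :* (k :* n)) ≡.refl k j n)
        (≡.trans (≡.cong (j ℕ.*_) r)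
        (≡.sym (ℕₚ.*-assoc j l o))))))
        (begin
          (k ℕ.* i) · x  ≈⟨ ×-assocˡ x k i ⟨
          k · (i · x)    ≈⟨ ×-congʳ k q ⟩
          k · (j · y)    ≈⟨ ·-·-comm k j y ⟩
          j · (k · y)    ≈⟨ ×-congʳ j s ⟩
          j · (l · z)    ≈⟨ ×-assocˡ z j l ⟩
          (j ℕ.* l) · z  ∎)
      where open +-*-Solver

    cong-+ℚ : ∀ {x y u v} → x ≃ y → u ≃ v → (x +ℚ u) ≃ (y +ℚ v)
    cong-+ℚ {x / m} {y / n} {u / o} {v / r} (witness i j p q) (witness k l s t) =
      witness (i ℕ.* k) (j ℕ.* l)
        {{ℕₚ.m*n≢0 i k}} {{ℕₚ.m*n≢0 j l}}
        (≡.trans (shuffle i k m o)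
        (≡.trans (≡.cong₂ ℕ._*_ p s)
        (≡.sym (shuffle j l n r))))
        (begin
          (i ℕ.* k) · (o · x + m · u)
            ≈⟨ expand i k o m x u ⟩
          (k ℕ.* o) · (i · x) + (i ℕ.* m) · (k · u)
            ≈⟨ +-cong (×-cong s q) (×-cong p t) ⟩
          (l ℕ.* r) · (j · y) + (j ℕ.* n) · (l · v)
            ≈⟨ expand j l r n y v ⟨
          (j ℕ.* l) · (r · y + n · v) ∎)
      where
      open +-*-Solver

      shuffle : ∀ i k m o →
                (i ℕ.* k) ℕ.* (m ℕ.* o) ≡ (i ℕ.* m) ℕ.* (k ℕ.* o)
      shuffle = solve 4 (λ i k m o →
        (i :* k) :* (m :* o) := (i :* m) :* (k :* o)) ≡.refl

      expand : ∀ i k o m x u → (i ℕ.* k) · (o · x + m · u) ≈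
               (k ℕ.* o) · (i · x) + (i ℕ.* m) · (k · u)
      expand i k o m x u = begin
        (i ℕ.* k) · (o · x + m · u)
          ≈⟨ ×-distrib-+ (o · x) (m · u) (i ℕ.* k) ⟩
        (i ℕ.* k) · (o · x) + (i ℕ.* k) · (m · u)
          ≈⟨ +-cong (×-assocˡ x (i ℕ.* k) o) (×-assocˡ u (i ℕ.* k) m) ⟩
        ((i ℕ.* k) ℕ.* o) · x + ((i ℕ.* k) ℕ.* m) · u
          ≈⟨ +-cong
               (×-congˡ (solve 3 (λ i k o →
                 (i :* k) :* o := (k :* o) :* i) ≡.refl i k o))
               (×-congˡ (solve 3 (λ i k m →
                 (i :* k) :* m := (i :* m) :* k) ≡.refl i k m)) ⟩
        ((k ℕ.* o) ℕ.* i) · x + ((i ℕ.* m) ℕ.* k) · u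
          ≈⟨ +-cong (×-assocˡ x (k ℕ.* o) i) (×-assocˡ u (i ℕ.* m) k) ⟨
        (k ℕ.* o) · (i · x) + (i ℕ.* m) · (k · u) ∎

    assoc-+ℚ : ∀ x y z → ((x +ℚ y) +ℚ z) ≃ (x +ℚ (y +ℚ z))
    assoc-+ℚ (_/_ x m {{m≢0}}) (y / n) (z / o) =
      same-den {{ℕₚ.m*n≢0 (m ℕ.* n) o {{ℕₚ.m*n≢0 m n}}}}
               {{ℕₚ.m*n≢0 m (n ℕ.* o) {{m≢0}} {{ℕₚ.m*n≢0 n o}}}}
        (begin
          o · (n · x + m · y) + (m ℕ.* n) · z
            ≈⟨ +-cong (×-distrib-+ (n · x) (m · y) o) (sym (×-assocˡ z m n)) ⟩
          (o · (n · x) + o · (m · y)) + m · (n · z)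
            ≈⟨ assoc _ _ _ ⟩
          o · (n · x) + (o · (m · y) + m · (n · z))
            ≈⟨ +-cong
                 (trans (·-·-comm o n x) (×-assocˡ x n o))
                 (+-congʳ (·-·-comm o m y)) ⟩
          (n ℕ.* o) · x + (m · (o · y) + m · (n · z))
            ≈⟨ +-congˡ (×-distrib-+ (o · y) (n · z) m) ⟨
          (n ℕ.* o) · x + m · (o · y + n · z) ∎)
        (ℕₚ.*-assoc m n o)

    comm-+ℚ : ∀ x y → (x +ℚ y) ≃ (y +ℚ x)
    comm-+ℚ (x / m) (y / n) =
      same-den {{ℕₚ.m*n≢0 m n}} {{ℕₚ.m*n≢0 n m}}
        (comm (n · x) (m · y)) (ℕₚ.*-comm m n)

    identityˡ-+ℚ : ∀ x → (0ℚ +ℚ x) ≃ x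
    identityˡ-+ℚ (x / m) =
      same-den {{ℕₚ.m*n≢0 1 m}}
        (trans (+-cong (·-0# m) (×-homo-1 x)) (identityˡ x))
        (ℕₚ.*-identityˡ m)

  colimit : CommutativeMonoid c ℓ
  colimit = record
    { Carrier = Fraction Carrier
    ; _≈_ = _≃_
    ; _∙_ = _+ℚ_
    ; ε = 0ℚ
    ; isCommutativeMonoid = record
      { isMonoid = record
        { isSemigroup = record
          { isMagma = record
            { isEquivalence = record
              { refl = same-den refl ≡.refl
              ; sym = λ (witness i j p q) → witness j i (≡.sym p) (sym q)
              ; trans = trans-≃
              }
            ; ∙-cong = cong-+ℚ
            }
          ; assoc = assoc-+ℚ
          }
        ; identity = identityˡ-+ℚ
                   , λ x → trans-≃ (comm-+ℚ x 0ℚ) (identityˡ-+ℚ x)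
        }
      ; comm = comm-+ℚ
      }
    }

infix 8 _ℚ≥0 _⊗ℚ

_ℚ≥0 : CommutativeMonoid c ℓ → CommutativeMonoid c ℓ
M ℚ≥0 = Colimit.colimit M

-- The tensor product of an abelian group G with ℚ over ℤ, as the localization
-- of G at the positive integers: since ℚ is the colimit of the groups (1/n) ℤ
-- and tensor products commute with colimits, G ⊗ ℚ is the colimit of the
-- groups (1/n) G.
_⊗ℚ : AbelianGroup c ℓ → AbelianGroup c ℓ
G ⊗ℚ = record
  { Carrier = Gℚ.Carrier
  ; _≈_ = Gℚ._≈_
  ; _∙_ = Gℚ._∙_
  ; ε = Gℚ.ε
  ; _⁻¹ = mapFraction G._⁻¹
  ; isAbelianGroup = record
    { isGroup = record
      { isMonoid = Gℚ.isMonoid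
      ; inverse = inverseˡ
                , λ x → Gℚ.trans (Gℚ.comm x (mapFraction G._⁻¹ x)) (inverseˡ x)
      ; ⁻¹-cong = λ {x} {y} → neg-cong {x} {y}
      }
    ; comm = Gℚ.comm
    }
  }
  where
  module G = AbelianGroup G
  module Gℚ = CommutativeMonoid (G.commutativeMonoid ℚ≥0)
  open Colimit G.commutativeMonoid
  open CommutativeMonoidMult G.commutativeMonoid renaming (_×_ to _·_)
  open AbelianGroupProperties G using (⁻¹-∙-comm; ε⁻¹≈ε)

  ·-⁻¹ : ∀ n x → n · (x G.⁻¹) G.≈ (n · x) G.⁻¹
  ·-⁻¹ ℕ.zero    x = G.sym ε⁻¹≈ε
  ·-⁻¹ (ℕ.suc n) x =
    G.trans (G.∙-congˡ (·-⁻¹ n x)) (⁻¹-∙-comm x (n · x))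

  ·-ε : ∀ n → n · G.ε G.≈ G.ε
  ·-ε ℕ.zero    = G.refl
  ·-ε (ℕ.suc n) = G.trans (G.identityˡ _) (·-ε n)

  neg-cong : ∀ {x y} → x ≃ y → mapFraction G._⁻¹ x ≃ mapFraction G._⁻¹ y
  neg-cong {x / _} {y / _} (witness i j p q) = witness i j p
    (G.trans (·-⁻¹ i x) (G.trans (G.⁻¹-cong q) (G.sym (·-⁻¹ j y))))

  inverseˡ : ∀ x → (mapFraction G._⁻¹ x +ℚ x) ≃ 0ℚ
  inverseˡ (x / m) = witness 1 (m ℕ.* m) {{_}} {{ℕₚ.m*n≢0 m m}}
    (≡.trans (ℕₚ.*-identityˡ (m ℕ.* m)) (≡.sym (ℕₚ.*-identityʳ (m ℕ.* m))))
    (G.trans (×-homo-1 _)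
    (G.trans (G.∙-congʳ (·-⁻¹ m x))
    (G.trans (G.inverseˡ (m · x))
    (G.sym (·-ε (m ℕ.* m))))))

module _ (M : CommutativeMonoid c ℓ) where

  open CommutativeMonoid M renaming (_∙_ to _+_; ε to 0#)
  open CommutativeMonoidMult M renaming (_×_ to _·_)
  open MonoidSum monoid using (sum)
  open GroupEnvelope M using (ι)

  private
    module Mᵍᵖ = AbelianGroup (M ᵍᵖ)
    open CommutativeMonoidMult Mᵍᵖ.commutativeMonoid
      using () renaming (_×_ to _·ᵍᵖ_)

  TorsionFree : Set (c ⊔ ℓ)
  TorsionFree = ∀ (g : Mᵍᵖ.Carrier) n .{{_ : NonZero n}} →
                n ·ᵍᵖ g Mᵍᵖ.≈ Mᵍᵖ.ε → g Mᵍᵖ.≈ Mᵍᵖ.ε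

  IsIntegral : Set (c ⊔ ℓ)
  IsIntegral = Injective _≈_ Mᵍᵖ._≈_ ι

  record IsSaturated : Set (c ⊔ ℓ) where
    field
      isIntegral : IsIntegral
      saturated  : ∀ (g : Mᵍᵖ.Carrier) n .{{_ : NonZero n}} →
                   n ·ᵍᵖ g ∈ Image Mᵍᵖ.setoid ι → g ∈ Image Mᵍᵖ.setoid ι

  IsFinitelyGenerated : Set (c ⊔ ℓ)
  IsFinitelyGenerated =
    ∃[ r ] Σ (Fin r → Carrier) λ gen →
      ∀ x → Σ (Fin r → ℕ) λ k → x ≈ sum (λ i → k i · gen i)

  record IsFs : Set (c ⊔ ℓ) where
    field
      isSaturated         : IsSaturated
      isFinitelyGenerated : IsFinitelyGenerated

  IsSharp : Set (c ⊔ ℓ)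
  IsSharp = ∀ x y → x + y ≈ 0# → x ≈ 0#

  record IsToric : Set (c ⊔ ℓ) where
    field
      isSharp : IsSharp
      isFs    : IsFs

PseudoSaturated :
  (P : CommutativeMonoid a b) (Q : CommutativeMonoid c ℓ) →
  MonoidHomomorphism (CommutativeMonoid.rawMonoid P)
                     (CommutativeMonoid.rawMonoid Q) →
  Set (a ⊔ b ⊔ c ⊔ ℓ)
PseudoSaturated P Q u =
  ∃[ M ] NonZero M ×
    (∀ n .{{_ : NonZero n}} (x : P.Carrier) (y : Q.Carrier) →
      ⟦ x ⟧ ∣Q (n ·Q y) →
      ∃[ x′ ] ((M ·P x) ∣P (n ·P x′)) × (⟦ x′ ⟧ ∣Q (M ·Q y)))
  where
  module P = CommutativeMonoid P
  module Q = CommutativeMonoid Q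
  open MonoidHomomorphism u using (⟦_⟧)
  open CommutativeMonoidMult P using () renaming (_×_ to _·P_)
  open CommutativeMonoidMult Q using () renaming (_×_ to _·Q_)
  _∣P_ = _∣ˡ_ P.rawMagma
  _∣Q_ = _∣ˡ_ Q.rawMagma

record Submonoid (Q : CommutativeMonoid c ℓ) p : Set (c ⊔ ℓ ⊔ suc p) where
  open CommutativeMonoid Q
  field
    Member   : Pred Carrier p
    respects : ∀ {x y} → x ≈ y → x ∈ Member → y ∈ Member
    0-closed : ε ∈ Member
    +-closed : ∀ {x y} → x ∈ Member → y ∈ Member → x ∙ y ∈ Member

  private
    rawSubmonoid : RawMonoid (c ⊔ p) ℓ
    rawSubmonoid = record
      { Carrier = Σ Carrier Member
      ; _≈_ = λ x y → proj₁ x ≈ proj₁ y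
      ; _∙_ = λ (x , x∈P) (y , y∈P) → x ∙ y , +-closed x∈P y∈P
      ; ε = ε , 0-closed
      }

    proj₁-isMonomorphism : IsMonoidMonomorphism rawSubmonoid rawMonoid proj₁
    proj₁-isMonomorphism = record
      { isMonoidHomomorphism = record
        { isMagmaHomomorphism = record
          { isRelHomomorphism = record { cong = λ x≈y → x≈y }
          ; homo = λ _ _ → refl
          }
        ; ε-homo = refl
        }
      ; injective = λ x≈y → x≈y
      }

  commutativeMonoid : CommutativeMonoid (c ⊔ p) ℓ
  commutativeMonoid = record
    { isCommutativeMonoid =
        MonoidMonomorphism.isCommutativeMonoid
          proj₁-isMonomorphism isCommutativeMonoid
    }

  inclusion : MonoidHomomorphism rawSubmonoid rawMonoid
  inclusion = record
    { isMonoidHomomorphism =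
        IsMonoidMonomorphism.isMonoidHomomorphism proj₁-isMonomorphism
    }

module _ {Q : CommutativeMonoid c ℓ} (P : Submonoid Q p) where

  open GroupEnvelope Q using (ι)

  private
    module P = Submonoid P
    module Q = CommutativeMonoid Q
    module Qᵍᵖ = AbelianGroup (Q ᵍᵖ)
    module V = AbelianGroup (Q ᵍᵖ ⊗ℚ)

  IntersectsNegTrivially : Set (c ⊔ ℓ ⊔ p)
  IntersectsNegTrivially =
    ∀ (g : Qᵍᵖ.Carrier) →
    g ∈ Image Qᵍᵖ.setoid ι →
    g ∈ Image Qᵍᵖ.setoid (λ ((x , _) : Σ Q.Carrier P.Member) → ι x Qᵍᵖ.⁻¹) →
    g Qᵍᵖ.≈ Qᵍᵖ.ε

  -- The colimits of Q and of P viewed as subsets of Qᵍᵖ ⊗ ℚ.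
  Qℚ≥0 : Pred V.Carrier (c ⊔ ℓ)
  Qℚ≥0 = Image {A = CommutativeMonoid.Carrier (Q ℚ≥0)} V.setoid (mapFraction ι)

  Pℚ≥0 : Pred V.Carrier (c ⊔ ℓ ⊔ p)
  Pℚ≥0 = Image {A = CommutativeMonoid.Carrier (P.commutativeMonoid ℚ≥0)} V.setoid
           (mapFraction (λ (x , _) → ι x))

  record IsMinimalDecomposition (y : V.Carrier) (y′x′ : V.Carrier × V.Carrier) :
                                Set (c ⊔ ℓ ⊔ p) where
    private
      y′ = proj₁ y′x′
      x′ = proj₂ y′x′
    field
      decomposes : y V.≈ y′ V.∙ x′
      y′∈Qℚ≥0    : y′ ∈ Qℚ≥0
      x′∈Pℚ≥0    : x′ ∈ Pℚ≥0
      minimal    : ∀ x → x ∈ Pℚ≥0 → ¬ (x V.≈ V.ε) → (y′ V.- x) ∉ Qℚ≥0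

{-# OPTIONS --safe #-}
module Submission where

-- Clearing denominators, everything takes place inside Q: y is minimal when no
-- multiple of y is divisible by a nonzero element of P.
--
-- If u is pseudo-saturated with constant M, minimal decompositions exist because a
-- maximal divisor of M y in P, which exists by Dickson's lemma, leaves a minimal rest.
-- If y₁ + x₁ = y₂ + x₂ are two of them, each convex combination (k x₁ + x₂) / (k + 1)
-- has an upper bound in (1/M) P, and by Dickson's lemma two of these bounds coincide.
-- Along the segment the common bound moves past x₁ by an element of P, which is zero
-- by minimality of y₁; so the bound is x₁, whence x₂ ≤ x₁, and x₁ = x₂ by minimality
-- of y₂.
--
-- Conversely, the P-part is the largest lower bound of y in the cone of P, and on the
-- sum of P and a face of minimal elements it is additive, so only its denominators
-- must be bounded: they are bounded on each such group, uniformly in the face.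

open import Defs
open import Level using (Level; _⊔_; 0ℓ; Lift; lift; lower)
open import Algebra.Bundles using (CommutativeMonoid; AbelianGroup)
open import Algebra.Definitions.RawMagma using (_∣ˡ_; _,_)
import Algebra.Properties.CommutativeMonoid.Mult as Mult
import Algebra.Properties.CommutativeMonoid.Sum as Sum
import Algebra.Properties.AbelianGroup as AbelianGroupProperties
import Algebra.Properties.CommutativeSemigroup as CommutativeSemigroupProperties
import Algebra.Solver.CommutativeMonoid as MonoidSolver
open import Axiom.ExcludedMiddle using (ExcludedMiddle)
open import Data.Fin.Base using (Fin; zero; suc)
open import Data.Nat.Base as ℕ using (ℕ; zero; suc; NonZero; _≤_; _<_; _∸_)
open import Data.Nat.Induction using (<-wellFounded)
open import Data.Nat.Divisibility as ℕ∣ using (divides)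
import Data.Nat.Properties as ℕₚ
open import Data.Product using (∃!; Σ; ∃; ∃-syntax; _×_; _,_; proj₁; proj₂)
open import Data.Product.Relation.Binary.Pointwise.NonDependent using (Pointwise)
open import Data.Sum.Base using (inj₁; inj₂)
open import Function.Base using (_∘_)
open import Function.Bundles using (_⇔_; mk⇔)
open import Induction.WellFounded using (Acc; acc)
open import Relation.Binary.Core using (Rel)
open import Relation.Binary.Definitions using (Transitive)
open import Relation.Binary.PropositionalEquality as ≡ using (_≡_)
import Relation.Binary.Reasoning.Setoid as SetoidReasoning
open import Relation.Nullary using (¬_; yes; no; recompute)
open import Relation.Nullary.Decidable using (map′; decidable-stable)
open import Relation.Unary using (Pred; _∈_)

private
  module ℕSum = Sum ℕₚ.+-0-commutativeMonoid

  variable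
    a b c ℓ ℓ₁ ℓ₂ ℓ₃ p : Level
    A : Set a
    B : Set b

-- Least elements and chains, classically

lower-em : ∀ a b → ExcludedMiddle (a ⊔ b) → ExcludedMiddle a
lower-em a b em {P} = map′ lower lift (em {Lift b P})

least-witness : {A : Set a} {P : Pred A p} → ExcludedMiddle (a ⊔ p) →
                (size : A → ℕ) → ∃ P →
                ∃[ x ] P x × (∀ y → P y → size x ≤ size y)
least-witness {A = A} {P} em size (x , Px) = go x Px (<-wellFounded (size x))
  where
  go : ∀ x → P x → Acc _<_ (size x) → ∃[ x ] P x × (∀ y → P y → size x ≤ size y)
  go x Px (acc smaller) with em {∃[ y ] P y × size y < size x}
  ... | yes (y , Py , y<x) = go y Py (smaller y<x)
  ... | no  none = x , Px , λ y Py → ℕₚ.≮⇒≥ λ y<x → none (y , Py , y<x)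

chain : {R : Rel A ℓ} → Transitive R → (s : ℕ → A) →
        (∀ i → R (s i) (s (suc i))) → ∀ {i j} → i < j → R (s i) (s j)
chain {R = R} R-trans s step {i} {suc j} i<1+j with ℕₚ.m<1+n⇒m<n∨m≡n i<1+j
... | inj₁ i<j    = R-trans (chain {R = R} R-trans s step i<j) (step j)
... | inj₂ ≡.refl = step i

-- Dickson's lemma

-- The well-quasi-order property in its infinite form. A single ascending pair would not survive
-- products; a whole subsequence can be thinned out once more.
AscendingSubsequences : {A : Set a} → Rel A ℓ → Set (a ⊔ ℓ)
AscendingSubsequences {A = A} R = (s : ℕ → A) → Σ (ℕ → ℕ) λ g →
  (∀ {i j} → i < j → g i < g j) × (∀ {i j} → i < j → R (s (g i)) (s (g j)))

-- `R` relates all pairs of the first subsequence, not only neighbours, so it survives the second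
-- thinning, which is made for `S`.
×-ascending : {R : Rel A ℓ₁} {S : Rel B ℓ₂} →
              AscendingSubsequences R → AscendingSubsequences S →
              AscendingSubsequences (Pointwise R S)
×-ascending R-asc S-asc s =
  let g , g-mono , g-asc = R-asc (proj₁ ∘ s)
      f , f-mono , f-asc = S-asc (proj₂ ∘ s ∘ g)
  in g ∘ f , g-mono ∘ f-mono , λ i<j → g-asc (f-mono i<j) , f-asc i<j

map-ascending : {R : Rel A ℓ₁} {S : Rel B ℓ₂} (f : B → A) →
                (∀ {x y} → R (f x) (f y) → S x y) →
                AscendingSubsequences R → AscendingSubsequences S
map-ascending f R⇒S R-asc s =
  let g , g-mono , g-asc = R-asc (f ∘ s)
  in g , g-mono , λ i<j → R⇒S (g-asc i<j)

-- `g i` is an index where `s` is least on the tail from `start i`, and each tail starts just after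
-- the previous choice. The least value of a tail is below all later values.
≤-ascending : ExcludedMiddle 0ℓ → AscendingSubsequences _≤_
≤-ascending em s = g , g-mono , λ {i} {j} i<j →
  proj₂ (proj₂ (tail-least (start i))) (g j)
    (ℕₚ.≤-trans (start≤g i) (ℕₚ.<⇒≤ (g-mono i<j)))
  where
  tail-least : ∀ n → ∃[ m ] n ≤ m × (∀ k → n ≤ k → s m ≤ s k)
  tail-least n = least-witness em s (n , ℕₚ.≤-refl)

  start : ℕ → ℕ
  g     : ℕ → ℕ
  start zero    = zero
  start (suc i) = suc (g i)
  g i = proj₁ (tail-least (start i))

  start≤g : ∀ i → start i ≤ g i
  start≤g i = proj₁ (proj₂ (tail-least (start i)))

  g-mono : ∀ {i j} → i < j → g i < g j
  g-mono = chain {R = _<_} ℕₚ.<-trans g λ i → start≤g (suc i)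

_≤ᵥ_ : ∀ {r} → Rel (Fin r → ℕ) 0ℓ
f ≤ᵥ g = ∀ i → f i ≤ g i

≤ᵥ-ascending : ExcludedMiddle 0ℓ → ∀ r → AscendingSubsequences (_≤ᵥ_ {r})
≤ᵥ-ascending em zero    s = (λ i → i) , (λ i<j → i<j) , λ _ ()
≤ᵥ-ascending em (suc r) =
  map-ascending {R = Pointwise _≤_ _≤ᵥ_} {S = _≤ᵥ_} (λ f → f zero , f ∘ suc)
    (λ (≤₀ , ≤ₛ) → λ { zero → ≤₀ ; (suc i) → ≤ₛ i })
    (×-ascending {R = _≤_} {S = _≤ᵥ_} (≤-ascending em) (≤ᵥ-ascending em r))

sum≡0⇒≡0 : ∀ {r} (k : Fin r → ℕ) → ℕSum.sum k ≡ 0 → ∀ i → k i ≡ 0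
sum≡0⇒≡0 k eq zero    = ℕₚ.m+n≡0⇒m≡0 (k zero) eq
sum≡0⇒≡0 k eq (suc i) = sum≡0⇒≡0 (k ∘ suc) (ℕₚ.m+n≡0⇒n≡0 (k zero) eq) i

+-nonZero : ∀ m n .{{_ : NonZero m}} → NonZero (m ℕ.+ n)
+-nonZero (suc _) _ = _

-- Arithmetic in groups, integral monoids and saturated monoids

module Subtraction (G : AbelianGroup c ℓ) where

  open AbelianGroup G
  open AbelianGroupProperties G using (xyx⁻¹≈y)

  x∙[y-x]≈y : ∀ x y → x ∙ (y - x) ≈ y
  x∙[y-x]≈y x y = trans (sym (assoc x y (x ⁻¹))) (xyx⁻¹≈y x y)

  y≈x∙z⇒y-x≈z : ∀ y x z → y ≈ x ∙ z → y - x ≈ z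
  y≈x∙z⇒y-x≈z y x z eq = trans (∙-congʳ eq) (xyx⁻¹≈y x z)

module ScalarMultiples (M : CommutativeMonoid c ℓ) where

  open CommutativeMonoid M
    renaming ( _∙_ to _+_; ε to 0#; ∙-cong to +-cong; ∙-congʳ to +-congʳ
             ; ∙-congˡ to +-congˡ; identityˡ to +-identityˡ; identityʳ to +-identityʳ)
    public
  open Mult M renaming (_×_ to infixr 8 _·_) public
  open MonoidSolver M using (solve; _⊜_; _⊕_) public
  open CommutativeSemigroupProperties commutativeSemigroup using (interchange) public
  open GroupEnvelope M public
  module Mᵍᵖ = AbelianGroup (M ᵍᵖ)
  open Mult Mᵍᵖ.commutativeMonoid using () renaming (_×_ to infixr 8 _·ᵍᵖ_) public

  ·-comm : ∀ m n x → m · n · x ≈ n · m · x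
  ·-comm m n x = begin
    m · n · x      ≈⟨ ×-assocˡ x m n ⟩
    (m ℕ.* n) · x  ≈⟨ ×-congˡ (ℕₚ.*-comm m n) ⟩
    (n ℕ.* m) · x  ≈⟨ ×-assocˡ x n m ⟨
    n · m · x      ∎
    where open SetoidReasoning setoid

  ·-zeroʳ : ∀ n → n · 0# ≈ 0#
  ·-zeroʳ zero    = refl
  ·-zeroʳ (suc n) = trans (+-identityˡ _) (·-zeroʳ n)

  ·ᵍᵖ-⊖ : ∀ n x y → n ·ᵍᵖ (x ⊖ y) ≡ n · x ⊖ n · y
  ·ᵍᵖ-⊖ zero    x y = ≡.refl
  ·ᵍᵖ-⊖ (suc n) x y = ≡.cong ((x ⊖ y) +ᵍᵖ_) (·ᵍᵖ-⊖ n x y)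

  ⊖≈ι : ∀ {x y z} → x ≈ y + z → x ⊖ y ≈ᵍᵖ ι z
  ⊖≈ι {x} {y} {z} eq = witness 0# (+-congʳ (trans (+-identityʳ x) (trans eq (comm y z))))

  module Integral (integral : IsIntegral M) where

    +-cancelʳ : ∀ {x y} z → x + z ≈ y + z → x ≈ y
    +-cancelʳ z eq = integral (witness z
      (trans (+-congʳ (+-identityʳ _)) (trans eq (sym (+-congʳ (+-identityʳ _))))))

    +-cancelˡ : ∀ {x y} z → z + x ≈ z + y → x ≈ y
    +-cancelˡ z eq = +-cancelʳ z (trans (comm _ z) (trans eq (comm z _)))

    ⊖≈ι⁻¹ : ∀ {x y z} → x ⊖ y ≈ᵍᵖ ι z → x ≈ y + z
    ⊖≈ι⁻¹ {x} {y} {z} (witness k eq) =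
      trans (sym (+-identityʳ x)) (trans (+-cancelʳ k eq) (comm z y))

    ·-cancel : TorsionFree M → ∀ n .{{_ : NonZero n}} {x y} → n · x ≈ n · y → x ≈ y
    ·-cancel torsionFree n {x} {y} eq = trans
      (⊖≈ι⁻¹ (torsionFree (x ⊖ y) n
        (≡.subst (_≈ᵍᵖ 0ᵍᵖ) (≡.sym (·ᵍᵖ-⊖ n x y)) (⊖≈ι (trans eq (sym (+-identityʳ _)))))))
      (+-identityʳ y)

  module Saturated (isSaturated : IsSaturated M) where

    open Integral (IsSaturated.isIntegral isSaturated) public

    -- `n` times `x ⊖ y` is the element `z` of the monoid, so saturation puts `x ⊖ y` itself in the
    -- monoid. This is how divisibilities are divided by `n` below.
    ·-∣-cancel : ∀ n .{{_ : NonZero n}} {x y z} → n · x ≈ n · y + z →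
                 ∃[ w ] x ≈ y + w × n · w ≈ z
    ·-∣-cancel n {x} {y} {z} eq =
      let w , ιw≈ = IsSaturated.saturated isSaturated (x ⊖ y) n
            (z , ≡.subst (ι z ≈ᵍᵖ_) (≡.sym (·ᵍᵖ-⊖ n x y)) (Mᵍᵖ.sym (⊖≈ι eq)))
          x≈y+w = ⊖≈ι⁻¹ (Mᵍᵖ.sym ιw≈)
      in w , x≈y+w ,
         +-cancelˡ (n · y) (trans (sym (×-distrib-+ y w n)) (trans (sym (×-congʳ n x≈y+w)) eq))

-- Coordinates in finitely generated monoids

module FinitelyGenerated (M : CommutativeMonoid c ℓ) (fg : IsFinitelyGenerated M) where

  open ScalarMultiples M
  open Sum M using (sum; sum-cong-≋; sum-replicate-zero; ∑-distrib-+)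

  rank = proj₁ fg

  combination : (Fin rank → ℕ) → Carrier
  combination k = sum λ i → k i · proj₁ (proj₂ fg) i

  coordinates : Carrier → Fin rank → ℕ
  coordinates x = proj₁ (proj₂ (proj₂ fg) x)

  combination-coordinates : ∀ x → x ≈ combination (coordinates x)
  combination-coordinates x = proj₂ (proj₂ (proj₂ fg) x)

  combination-∸ : ∀ {k l} → k ≤ᵥ l →
                  combination k + combination (λ i → l i ∸ k i) ≈ combination l
  combination-∸ {k} {l} k≤l = trans (sym (∑-distrib-+ (λ i → k i · _) (λ i → (l i ∸ k i) · _))) (sum-cong-≋ λ i →
    trans (sym (×-homo-+ _ (k i) (l i ∸ k i))) (×-congˡ (ℕₚ.m+[n∸m]≡n (k≤l i))))

  -- A coordinatewise inequality makes the coefficient differences natural numbers, and their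
  -- combination is the quotient; so Dickson's lemma carries over to divisibility.
  ∣-ascending : ExcludedMiddle 0ℓ → AscendingSubsequences (_∣ˡ_ rawMagma)
  ∣-ascending em = map-ascending {R = _≤ᵥ_} {S = _∣ˡ_ rawMagma} coordinates
    (λ {x} {y} x≤y → _ , trans (+-congʳ (combination-coordinates x))
                        (trans (combination-∸ x≤y) (sym (combination-coordinates y))))
    (≤ᵥ-ascending em rank)

  size : (Fin rank → ℕ) → ℕ
  size = ℕSum.sum

  size≡0⇒combination≈0 : ∀ k → size k ≡ 0 → combination k ≈ 0#
  size≡0⇒combination≈0 k size≡0 =
    trans (sum-cong-≋ λ i → ×-congˡ (sum≡0⇒≡0 k size≡0 i)) (sum-replicate-zero rank)

  size-∸ : ∀ {k l} → k ≤ᵥ l → size k ℕ.+ size (λ i → l i ∸ k i) ≡ size l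
  size-∸ {k} {l} k≤l = ≡.trans (≡.sym (ℕSum.∑-distrib-+ k _))
    (ℕSum.sum-cong-≗ λ i → ℕₚ.m+[n∸m]≡n (k≤l i))


-- The sets n⁻¹ (H v)ᵍᵖ ∩ Q are closed under subtraction in Q, so Dickson's lemma,
-- applied to the coordinates of v and y, yields a common denominator.
module CommonDenominator
  (Q : CommutativeMonoid c ℓ) (fg : IsFinitelyGenerated Q)
  (H : CommutativeMonoid.Carrier Q → Submonoid Q ℓ₃)
  (H-mono : ∀ {v w x} → _∣ˡ_ (CommutativeMonoid.rawMagma Q) v w →
            x ∈ Submonoid.Member (H v) → x ∈ Submonoid.Member (H w))
  where

  open ScalarMultiples Q
  open FinitelyGenerated Q fg
  open SetoidReasoning setoid

  private
    module H v = Submonoid (H v)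

  -- y belongs to n⁻¹ (H v)ᵍᵖ.
  record HasDenominator (v : Carrier) (n : ℕ) (y : Carrier) : Set (c ⊔ ℓ ⊔ ℓ₃) where
    constructor difference
    field
      {minuend subtrahend} : Carrier
      minuend∈H    : H.Member v minuend
      subtrahend∈H : H.Member v subtrahend
      equality     : n · y + subtrahend ≈ minuend

  ·-closed : ∀ {v x} n → H.Member v x → H.Member v (n · x)
  ·-closed zero    x∈H = H.0-closed _
  ·-closed (suc n) x∈H = H.+-closed _ x∈H (·-closed n x∈H)

  den-cong : ∀ {v n y z} → y ≈ z → HasDenominator v n y → HasDenominator v n z
  den-cong {n = n} y≈z (difference a∈H b∈H eq) =
    difference a∈H b∈H (trans (+-congʳ (×-congʳ n (sym y≈z))) eq)

  den-mono : ∀ {v w n y} → _∣ˡ_ rawMagma v w → HasDenominator v n y → HasDenominator w n y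
  den-mono v∣w (difference a∈H b∈H eq) = difference (H-mono v∣w a∈H) (H-mono v∣w b∈H) eq

  den-∣ : ∀ {v n N y} → n ℕ∣.∣ N → HasDenominator v n y → HasDenominator v N y
  den-∣ {n = n} {y = y} (divides m ≡.refl) (difference {a} {b} a∈H b∈H eq) =
    difference (·-closed m a∈H) (·-closed m b∈H) (begin
      (m ℕ.* n) · y + m · b  ≈⟨ +-congʳ (×-assocˡ y m n) ⟨
      m · n · y + m · b      ≈⟨ ×-distrib-+ (n · y) b m ⟨
      m · (n · y + b)        ≈⟨ ×-congʳ m eq ⟩
      m · a                  ∎)

  den-0 : ∀ {v y} n → y ≈ 0# → HasDenominator v n y
  den-0 n y≈0 = difference (H.0-closed _) (H.0-closed _)
    (trans (+-identityʳ _) (trans (×-congʳ n y≈0) (·-zeroʳ n)))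

  den-+ : ∀ {v n y z} → HasDenominator v n y → HasDenominator v n z →
          HasDenominator v n (y + z)
  den-+ {n = n} {y} {z} (difference {a} {b} a∈H b∈H eq) (difference {a′} {b′} a′∈H b′∈H eq′) =
    difference (H.+-closed _ a∈H a′∈H) (H.+-closed _ b∈H b′∈H) (begin
      n · (y + z) + (b + b′)        ≈⟨ +-congʳ (×-distrib-+ y z n) ⟩
      (n · y + n · z) + (b + b′)    ≈⟨ solve 4 (λ y z b b′ → (y ⊕ z) ⊕ (b ⊕ b′) ⊜ (y ⊕ b) ⊕ (z ⊕ b′))
                                         refl (n · y) (n · z) b b′ ⟩
      (n · y + b) + (n · z + b′)    ≈⟨ +-cong eq eq′ ⟩
      a + a′                        ∎)

  den-∸ : ∀ {v n y z} → HasDenominator v n (y + z) → HasDenominator v n y →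
          HasDenominator v n z
  den-∸ {n = n} {y} {z} (difference {a} {b} a∈H b∈H eq) (difference {a′} {b′} a′∈H b′∈H eq′) =
    difference (H.+-closed _ a∈H b′∈H) (H.+-closed _ b∈H a′∈H) (begin
      n · z + (b + a′)              ≈⟨ +-congˡ (+-congˡ eq′) ⟨
      n · z + (b + (n · y + b′))    ≈⟨ solve 4 (λ y z b b′ → z ⊕ (b ⊕ (y ⊕ b′)) ⊜ ((y ⊕ z) ⊕ b) ⊕ b′)
                                         refl (n · y) (n · z) b b′ ⟩
      ((n · y + n · z) + b) + b′    ≈⟨ +-congʳ (+-congʳ (×-distrib-+ y z n)) ⟨
      (n · (y + z) + b) + b′        ≈⟨ +-congʳ eq ⟩
      a + b′                        ∎)

  CommonDenominator : ℕ → Set (c ⊔ ℓ ⊔ ℓ₃)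
  CommonDenominator N = ∀ v n .{{_ : NonZero n}} y → HasDenominator v n y → HasDenominator v N y

  private
    -- `v` and `y` are given by coefficient vectors, since `size` must be additive under
    -- subtraction. The vector of a difference need not be the one that `coordinates` chooses for
    -- its combination.
    Candidate : Set
    Candidate = (Fin rank → ℕ) × (Fin rank → ℕ) × Σ ℕ NonZero

    denominator : Candidate → ℕ
    denominator (_ , _ , n , _) = n

    to-coordinates : ∀ {v n y} → HasDenominator v n y →
      HasDenominator (combination (coordinates v)) n (combination (coordinates y))
    to-coordinates {v} {n} {y} = den-mono (0# , trans (+-identityʳ v) (combination-coordinates v)) ∘
      den-cong (combination-coordinates y)

    from-coordinates : ∀ {v n y} →
      HasDenominator (combination (coordinates v)) n (combination (coordinates y)) → HasDenominator v n y
    from-coordinates {v} {n} {y} = den-mono (0# , trans (+-identityʳ _) (sym (combination-coordinates v))) ∘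
      den-cong (sym (combination-coordinates y))

    Bad : ℕ → Candidate → Set (c ⊔ ℓ ⊔ ℓ₃)
    Bad N (v , y , n , _) =
      HasDenominator (combination v) n (combination y) ×
      ¬ HasDenominator (combination v) N (combination y)

    SmallestBad : ℕ → Set (c ⊔ ℓ ⊔ ℓ₃)
    SmallestBad N = ∃[ x ] Bad N x × (∀ x′ → Bad N x′ → size (proj₁ (proj₂ x)) ≤ size (proj₁ (proj₂ x′)))

    -- A smallest counterexample is chosen for each of a divisibility chain of `N`, and Dickson's
    -- lemma finds an earlier one dominated by a later one. Their difference `d` either repairs the
    -- later one or is a counterexample too, and then the earlier `y` must be zero.
    no-bad-sequence : ExcludedMiddle 0ℓ → ExcludedMiddle (c ⊔ ℓ ⊔ ℓ₃) →
                      ¬ (∀ N → NonZero N → SmallestBad N)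
    no-bad-sequence em₀ em bad = absurd
      where
      N : ℕ → Σ ℕ NonZero
      x : ∀ k → SmallestBad (proj₁ (N k))
      -- Each new `N` absorbs the denominator of the last counterexample, so `N j` is a multiple of
      -- `n i` for every `i < j`.
      N zero    = 1 , _
      N (suc k) with proj₁ (x k)
      ... | _ , _ , n , n≢0 = n ℕ.* proj₁ (N k) , ℕₚ.m*n≢0 _ _ {{n≢0}} {{proj₂ (N k)}}
      x k = bad (proj₁ (N k)) (proj₂ (N k))

      vs ys : ℕ → Fin rank → ℕ
      vs k = proj₁ (proj₁ (x k))
      ys k = proj₁ (proj₂ (proj₁ (x k)))
      n : ℕ → ℕ
      n k = denominator (proj₁ (x k))

      n∣N : ∀ {i j} → i < j → n i ℕ∣.∣ proj₁ (N j)
      n∣N {i} {suc j} i<1+j with ℕₚ.m<1+n⇒m<n∨m≡n i<1+j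
      ... | inj₁ i<j    = ℕ∣.∣-trans (n∣N i<j) (ℕ∣.n∣m*n (n j))
      ... | inj₂ ≡.refl = ℕ∣.m∣m*n (proj₁ (N i))

      ascending = ×-ascending {R = _≤ᵥ_} {S = _≤ᵥ_} (≤ᵥ-ascending em₀ rank) (≤ᵥ-ascending em₀ rank)
        λ k → vs k , ys k
      g = proj₁ ascending
      i = g 0
      j = g 1
      i<j = proj₁ (proj₂ ascending) {0} {1} ℕ.z<s
      v≤ = proj₁ (proj₂ (proj₂ ascending) {0} {1} ℕ.z<s)
      y≤ = proj₂ (proj₂ (proj₂ ascending) {0} {1} ℕ.z<s)

      d : Fin rank → ℕ
      d l = ys j l ∸ ys i l

      yᵢ : HasDenominator (combination (vs j)) (n i) (combination (ys i))
      yᵢ = den-mono (_ , combination-∸ v≤) (proj₁ (proj₁ (proj₂ (x i))))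

      yⱼ : HasDenominator (combination (vs j)) (n j) (combination (ys i) + combination d)
      yⱼ = den-cong (sym (combination-∸ y≤)) (proj₁ (proj₁ (proj₂ (x j))))

      d-den : HasDenominator (combination (vs j)) (n j ℕ.* n i) (combination d)
      d-den = den-∸ (den-∣ (ℕ∣.m∣m*n (n i)) yⱼ) (den-∣ (ℕ∣.n∣m*n (n j)) yᵢ)

      absurd : _
      absurd with em {HasDenominator (combination (vs j)) (proj₁ (N j)) (combination d)}
      -- Now `N j` is a denominator of both `ys i` and `d`, hence of their sum `ys j`, contrary to
      -- the choice of `x j`.
      ... | yes d∈ = proj₂ (proj₁ (proj₂ (x j)))
            (den-cong (combination-∸ y≤) (den-+ (den-∣ (n∣N i<j) yᵢ) d∈))
      -- Here `d` competes with `ys j`, so `size (ys j) ≤ size d`. This leaves size zero for `ys i`,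
      -- and zero has every denominator.
      ... | no  d∉ = proj₂ (proj₁ (proj₂ (x i)))
            (den-0 (proj₁ (N i)) (size≡0⇒combination≈0 (ys i) (ℕₚ.n≤0⇒n≡0
              (ℕₚ.+-cancelʳ-≤ (size d) (size (ys i)) 0
                (≡.subst (_≤ size d) (≡.sym (size-∸ y≤))
                  (proj₂ (proj₂ (x j))
                    (vs j , d , n j ℕ.* n i ,
                     ℕₚ.m*n≢0 _ _ {{proj₂ (proj₂ (proj₂ (proj₁ (x j))))}}
                                   {{proj₂ (proj₂ (proj₂ (proj₁ (x i))))}})
                    (d-den , d∉)))))))

  commonDenominator : ExcludedMiddle (c ⊔ ℓ ⊔ ℓ₃) → ∃[ N ] NonZero N × CommonDenominator N
  commonDenominator em = decidable-stable em λ none →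
    no-bad-sequence (lower-em 0ℓ (c ⊔ ℓ ⊔ ℓ₃) em) em λ N N≢0 →
      least-witness em (λ x → size (proj₁ (proj₂ x)))
        (decidable-stable em λ no-bad → none (N , N≢0 , λ v n {{n≢0}} y y∈ →
          decidable-stable em λ y∉ → no-bad
            ( (coordinates v , coordinates y , n , recompute (ℕₚ.nonZero? n) n≢0)
            , to-coordinates y∈ , y∉ ∘ from-coordinates)))

-- Minimal elements and decompositions with denominators cleared

module Decompositions
  (em : ExcludedMiddle (c ⊔ ℓ ⊔ p)) (Q : CommutativeMonoid c ℓ) (P : Submonoid Q p)
  (torsionFree : TorsionFree Q) (Q-fs : IsFs Q) (P-toric : IsToric (Submonoid.commutativeMonoid P))
  (P∩-Q : IntersectsNegTrivially P)
  where

  private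
    module P where
      open Submonoid P public using (commutativeMonoid; inclusion)
      open ScalarMultiples commutativeMonoid public
      open IsToric P-toric public
      open Saturated (IsFs.isSaturated isFs) public

  open ScalarMultiples Q
  open Saturated (IsFs.isSaturated Q-fs)
  open SetoidReasoning setoid

  ⌊_⌋ : P.Carrier → Carrier
  ⌊_⌋ = proj₁

  ⌊·⌋ : ∀ n x → ⌊ n P.· x ⌋ ≈ n · ⌊ x ⌋
  ⌊·⌋ zero    x = refl
  ⌊·⌋ (suc n) x = +-congˡ (⌊·⌋ n x)

  -- Saturation of P, not of Q, is used: the quotient `w` has to lie in P.
  P-·-∣-cancel : ∀ n .{{_ : NonZero n}} {x y z} → n · ⌊ x ⌋ ≈ n · ⌊ y ⌋ + ⌊ z ⌋ →
                 ∃[ w ] ⌊ x ⌋ ≈ ⌊ y ⌋ + ⌊ w ⌋ × n · ⌊ w ⌋ ≈ ⌊ z ⌋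
  P-·-∣-cancel n {x} {y} {z} eq =
    let w , eq₁ , eq₂ = P.·-∣-cancel n {x} {y} {z}
          (trans (⌊·⌋ n x) (trans eq (+-congʳ (sym (⌊·⌋ n y)))))
    in w , eq₁ , trans (sym (⌊·⌋ n w)) eq₂

  ·-cancel-0 : ∀ n .{{_ : NonZero n}} {x} → n · x ≈ 0# → x ≈ 0#
  ·-cancel-0 n eq = ·-cancel torsionFree n (trans eq (sym (·-zeroʳ n)))

  -- The equation exhibits `z` as the negative of an element of P, so `z` lies in the trivial
  -- intersection of Q with -P.
  P∩-Q≈0 : ∀ {x z} → ⌊ x ⌋ + z ≈ 0# → ⌊ x ⌋ ≈ 0#
  P∩-Q≈0 {x} {z} x+z≈0 = begin
    ⌊ x ⌋        ≈⟨ +-identityʳ _ ⟨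
    ⌊ x ⌋ + 0#   ≈⟨ +-congˡ z≈0 ⟨
    ⌊ x ⌋ + z    ≈⟨ x+z≈0 ⟩
    0#           ∎
    where
    z≈0 : z ≈ 0#
    z≈0 = IsSaturated.isIntegral (IsFs.isSaturated Q-fs)
      (P∩-Q (ι z) (z , Mᵍᵖ.refl) (x , witness 0# (+-congʳ (begin
        0# + 0#      ≈⟨ +-identityˡ 0# ⟩
        0#           ≈⟨ x+z≈0 ⟨
        ⌊ x ⌋ + z    ≈⟨ comm ⌊ x ⌋ z ⟩
        z + ⌊ x ⌋    ∎))))

  -- The condition on y′ in a minimal decomposition, for y′ ∈ Q.
  Minimal : Carrier → Set (c ⊔ ℓ ⊔ p)
  Minimal y = ∀ k .{{_ : NonZero k}} {x z} → k · y ≈ ⌊ x ⌋ + z → ⌊ x ⌋ ≈ 0#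

  -- A divisor of `k · w` in P also divides `(k ℕ.* n) · v`. So minimality passes to the whole face
  -- generated by `v`.
  minimal-∣ : ∀ {v w r} n .{{_ : NonZero n}} → n · v ≈ w + r → Minimal v → Minimal w
  minimal-∣ {v} {w} {r} n n·v≈w+r v-min k {x} {z} k·w≈x+z =
    v-min (k ℕ.* n) {{ℕₚ.m*n≢0 k n}} {x} {z + k · r} (begin
      (k ℕ.* n) · v        ≈⟨ ×-assocˡ v k n ⟨
      k · n · v            ≈⟨ ×-congʳ k n·v≈w+r ⟩
      k · (w + r)          ≈⟨ ×-distrib-+ w r k ⟩
      k · w + k · r        ≈⟨ +-congʳ k·w≈x+z ⟩
      (⌊ x ⌋ + z) + k · r  ≈⟨ assoc _ _ _ ⟩
      ⌊ x ⌋ + (z + k · r)  ∎)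

  minimal-· : ∀ {v} n .{{_ : NonZero n}} → Minimal v → Minimal (n · v)
  minimal-· n = minimal-∣ n (sym (+-identityʳ _))

  minimal-cong : ∀ {v w} → v ≈ w → Minimal v → Minimal w
  minimal-cong v≈w = minimal-∣ 1 (trans (×-homo-1 _) (trans v≈w (sym (+-identityʳ _))))

  -- The minimal decomposition `y = residue / n + part / n`, multiplied by `n`.
  record Decomposition (n : ℕ) (y : Carrier) : Set (c ⊔ ℓ ⊔ p) where
    constructor decomposition
    field
      {residue}  : Carrier
      {part}     : P.Carrier
      minimal    : Minimal residue
      decomposes : n · y ≈ residue + ⌊ part ⌋

  record UniqueDecompositions : Set (c ⊔ ℓ ⊔ p) where
    field
      existence  : ∀ y → ∃[ n ] NonZero n × Decomposition n y
      uniqueness : ∀ {y₁ y₂ x₁ x₂} → Minimal y₁ → Minimal y₂ →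
                   y₁ + ⌊ x₁ ⌋ ≈ y₂ + ⌊ x₂ ⌋ → ⌊ x₁ ⌋ ≈ ⌊ x₂ ⌋

  private
    PS : Set (c ⊔ ℓ ⊔ p)
    PS = PseudoSaturated P.commutativeMonoid Q P.inclusion

    em₀ : ExcludedMiddle 0ℓ
    em₀ = lower-em 0ℓ (c ⊔ ℓ ⊔ p) em

    stable : {A : Set (c ⊔ ℓ ⊔ p)} → ¬ ¬ A → A
    stable = decidable-stable em

    ≈0-stable : ∀ {x} → ¬ ¬ (x ≈ 0#) → x ≈ 0#
    ≈0-stable = decidable-stable (lower-em ℓ (c ⊔ ℓ ⊔ p) em)

    Q-ascending = FinitelyGenerated.∣-ascending Q (IsFs.isFinitelyGenerated Q-fs) em₀
    P-ascending = FinitelyGenerated.∣-ascending P.commutativeMonoid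
      (IsFs.isFinitelyGenerated P.isFs) em₀

  -- Otherwise nonzero elements of P could be split off forever. Dickson's lemma gives two of the
  -- rests, the earlier dividing the later; since the later divides the earlier through a nonzero
  -- `d` in P, cancelling makes `d` invertible in Q, contradicting `P∩-Q≈0`.
  maximal-part : ∀ w → ∃[ x ] ∃[ y ] w ≈ ⌊ x ⌋ + y ×
                 (∀ {d z} → y ≈ ⌊ d ⌋ + z → ⌊ d ⌋ ≈ 0#)
  maximal-part w = stable λ none → no-descent λ x y w≈x+y → stable λ no-step →
    none (x , y , w≈x+y , λ {d} {z} y≈d+z → ≈0-stable λ d≉0 →
      no-step (z , d , d≉0 , y≈d+z))
    where
    Step : Rel Carrier (c ⊔ ℓ ⊔ p)
    Step y z = ∃[ d ] ¬ (⌊ d ⌋ ≈ 0#) × y ≈ ⌊ d ⌋ + z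

    Step-trans : Transitive Step
    -- Sharpness of P keeps the composite step nonzero.
    Step-trans (d , d≉0 , x≈d+y) (e , _ , y≈e+z) =
      d P.+ e , d≉0 ∘ P.isSharp d e , trans x≈d+y (trans (+-congˡ y≈e+z) (sym (assoc _ _ _)))

    no-descent : ¬ (∀ x y → w ≈ ⌊ x ⌋ + y → ∃ (Step y))
    no-descent step =
      let g , g-mono , ascending = Q-ascending (proj₁ ∘ state)
          d , d≉0 , eq = chain {R = Step} Step-trans (proj₁ ∘ state) descends (g-mono (ℕ.z<s {0}))
          e , eq′ = ascending {0} {1} ℕ.z<s
          y₀ = proj₁ (state (g 0))
      in d≉0 (P∩-Q≈0 {d} {e} (+-cancelˡ y₀ (begin
           y₀ + (⌊ d ⌋ + e)  ≈⟨ solve 3 (λ y d e → y ⊕ (d ⊕ e) ⊜ d ⊕ (y ⊕ e)) refl y₀ ⌊ d ⌋ e ⟩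
           ⌊ d ⌋ + (y₀ + e)  ≈⟨ +-congˡ eq′ ⟩
           ⌊ d ⌋ + proj₁ (state (g 1)) ≈⟨ eq ⟨
           y₀                ≈⟨ +-identityʳ y₀ ⟨
           y₀ + 0#           ∎)))
      where
      state : ℕ → Σ Carrier λ y → ∃[ x ] w ≈ ⌊ x ⌋ + y
      state zero    = w , P.0# , sym (+-identityˡ w)
      state (suc k) with state k
      ... | y , x , w≈x+y with step x y w≈x+y
      ...   | z , d , _ , y≈d+z = z , x P.+ d ,
              trans w≈x+y (trans (+-congˡ y≈d+z) (sym (assoc _ _ _)))

      descends : ∀ k → Step (proj₁ (state k)) (proj₁ (state (suc k)))
      descends k with state k
      ... | y , x , w≈x+y with step x y w≈x+y
      ...   | z , d , d≉0 , y≈d+z = d , d≉0 , y≈d+z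

  -- Pseudo-saturation implies unique decompositions

  module PseudoSaturated⇒Unique
    (M : ℕ) {{_ : NonZero M}}
    (pseudoSaturated : ∀ n .{{_ : NonZero n}} x y → _∣ˡ_ rawMagma ⌊ x ⌋ (n · y) →
      ∃[ x′ ] _∣ˡ_ P.rawMagma (M P.· x) (n P.· x′) × _∣ˡ_ rawMagma ⌊ x′ ⌋ (M · y))
    where

    -- If `x` in P divides `k · y′`, then `k x₀ + x` divides `k M y`. Pseudo-saturation turns this
    -- into a divisor `x′ = x₀ + d` of `M y` with `k M d = M x + u`. Maximality of `x₀` gives
    -- `d = 0`, and then sharpness and torsion-freeness give `x = 0`.
    residue-minimal : ∀ {y x₀ y′} → M · y ≈ ⌊ x₀ ⌋ + y′ →
                      (∀ {d z} → y′ ≈ ⌊ d ⌋ + z → ⌊ d ⌋ ≈ 0#) → Minimal y′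
    residue-minimal {y} {x₀} {y′} M·y≈x₀+y′ maximal k {x} {z} k·y′≈x+z =
      let x′ , (u , Mx+u≈) , (v , x′+v≈) = pseudoSaturated (k ℕ.* M) {{kM≢0}} (k P.· x₀ P.+ x) y (z , x∣kM·y)
          d , x′≈x₀+d , kM·d≈Mx+u = P-·-∣-cancel (k ℕ.* M) {{kM≢0}} {x′} {x₀} {M P.· x P.+ u} (begin
            (k ℕ.* M) · ⌊ x′ ⌋                          ≈⟨ ⌊·⌋ (k ℕ.* M) x′ ⟨
            ⌊ (k ℕ.* M) P.· x′ ⌋                        ≈⟨ Mx+u≈ ⟨
            ⌊ M P.· (k P.· x₀ P.+ x) ⌋ + ⌊ u ⌋          ≈⟨ +-congʳ (P.×-distrib-+ (k P.· x₀) x M) ⟩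
            (⌊ M P.· k P.· x₀ ⌋ + ⌊ M P.· x ⌋) + ⌊ u ⌋  ≈⟨ assoc _ _ _ ⟩
            ⌊ M P.· k P.· x₀ ⌋ + ⌊ M P.· x P.+ u ⌋      ≈⟨ +-congʳ (P.·-comm M k x₀) ⟩
            ⌊ k P.· M P.· x₀ ⌋ + ⌊ M P.· x P.+ u ⌋      ≈⟨ +-congʳ (P.×-assocˡ x₀ k M) ⟩
            ⌊ (k ℕ.* M) P.· x₀ ⌋ + ⌊ M P.· x P.+ u ⌋    ≈⟨ +-congʳ (⌊·⌋ (k ℕ.* M) x₀) ⟩
            (k ℕ.* M) · ⌊ x₀ ⌋ + ⌊ M P.· x P.+ u ⌋      ∎)
          d≈0 = maximal {d} {v} (+-cancelˡ ⌊ x₀ ⌋ (begin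
            ⌊ x₀ ⌋ + y′            ≈⟨ M·y≈x₀+y′ ⟨
            M · y                  ≈⟨ x′+v≈ ⟨
            ⌊ x′ ⌋ + v             ≈⟨ +-congʳ x′≈x₀+d ⟩
            (⌊ x₀ ⌋ + ⌊ d ⌋) + v   ≈⟨ assoc _ _ _ ⟩
            ⌊ x₀ ⌋ + (⌊ d ⌋ + v)   ∎))
      in ·-cancel-0 M (trans (sym (⌊·⌋ M x)) (P.isSharp (M P.· x) u
           (trans (sym kM·d≈Mx+u) (trans (×-congʳ (k ℕ.* M) d≈0) (·-zeroʳ (k ℕ.* M))))))
      where
      kM≢0 : NonZero (k ℕ.* M)
      kM≢0 = ℕₚ.m*n≢0 k M

      x∣kM·y : (⌊ k P.· x₀ ⌋ + ⌊ x ⌋) + z ≈ (k ℕ.* M) · y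
      x∣kM·y = begin
        (⌊ k P.· x₀ ⌋ + ⌊ x ⌋) + z  ≈⟨ assoc _ _ _ ⟩
        ⌊ k P.· x₀ ⌋ + (⌊ x ⌋ + z)  ≈⟨ +-cong (⌊·⌋ k x₀) (sym k·y′≈x+z) ⟩
        k · ⌊ x₀ ⌋ + k · y′         ≈⟨ ×-distrib-+ ⌊ x₀ ⌋ y′ k ⟨
        k · (⌊ x₀ ⌋ + y′)           ≈⟨ ×-congʳ k M·y≈x₀+y′ ⟨
        k · M · y                   ≈⟨ ×-assocˡ y k M ⟩
        (k ℕ.* M) · y               ∎

    existence : ∀ y → Decomposition M y
    existence y =
      let x₀ , y′ , M·y≈x₀+y′ , maximal = maximal-part (M · y)
      in decomposition {residue = y′} {part = x₀}
           (residue-minimal {x₀ = x₀} M·y≈x₀+y′ λ {d} {z} → maximal {d} {z})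
           (trans M·y≈x₀+y′ (comm ⌊ x₀ ⌋ y′))

    module _ {y₁ y₂ x₁ x₂} (y₁-minimal : Minimal y₁) (y₂-minimal : Minimal y₂)
             (y₁+x₁≈y₂+x₂ : y₁ + ⌊ x₁ ⌋ ≈ y₂ + ⌊ x₂ ⌋) where

      private
        X₁ = M · ⌊ x₁ ⌋
        X₂ = M · ⌊ x₂ ⌋
        Y₁ = M · y₁
        Y₂ = M · y₂

      Y₁+X₁≈Y₂+X₂ : Y₁ + X₁ ≈ Y₂ + X₂
      Y₁+X₁≈Y₂+X₂ = trans (sym (×-distrib-+ y₁ ⌊ x₁ ⌋ M))
        (trans (×-congʳ M y₁+x₁≈y₂+x₂) (×-distrib-+ y₂ ⌊ x₂ ⌋ M))

      -- part / M is an upper bound of the convex combination (k x₁ + x₂) / (k + 1).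
      record UpperBound (k : ℕ) : Set (c ⊔ ℓ ⊔ p) where
        constructor upperBound
        field
          part excess : P.Carrier
          rest        : Carrier
          bounds      : (k · X₁ + X₂) + ⌊ excess ⌋ ≈ suc k · ⌊ part ⌋
          splits      : ⌊ part ⌋ + rest ≈ Y₁ + X₁

      -- Adding `k` copies of the first decomposition to one copy of the second shows that
      -- `k x₁ + x₂` divides `(k + 1) (y₁ + x₁)`, so pseudo-saturation applies with `n = k + 1`.
      upper-bound : ∀ k → UpperBound k
      upper-bound k with pseudoSaturated (suc k) (k P.· x₁ P.+ x₂) (y₁ + ⌊ x₁ ⌋) (k · y₁ + y₂ , (begin
          (⌊ k P.· x₁ ⌋ + ⌊ x₂ ⌋) + (k · y₁ + y₂)
            ≈⟨ +-congʳ (+-congʳ (⌊·⌋ k x₁)) ⟩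
          (k · ⌊ x₁ ⌋ + ⌊ x₂ ⌋) + (k · y₁ + y₂)
            ≈⟨ solve 4 (λ kx x ky y → (kx ⊕ x) ⊕ (ky ⊕ y) ⊜ (y ⊕ x) ⊕ (ky ⊕ kx))
                 refl (k · ⌊ x₁ ⌋) ⌊ x₂ ⌋ (k · y₁) y₂ ⟩
          (y₂ + ⌊ x₂ ⌋) + (k · y₁ + k · ⌊ x₁ ⌋)
            ≈⟨ +-cong (sym y₁+x₁≈y₂+x₂) (sym (×-distrib-+ y₁ ⌊ x₁ ⌋ k)) ⟩
          suc k · (y₁ + ⌊ x₁ ⌋) ∎))
      ... | x , (u , Mx+u≈) , (v , x+v≈) = upperBound x u v (begin
          (k · X₁ + X₂) + ⌊ u ⌋                     ≈⟨ +-congʳ (+-congʳ (·-comm k M ⌊ x₁ ⌋)) ⟩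
          (M · k · ⌊ x₁ ⌋ + X₂) + ⌊ u ⌋             ≈⟨ +-congʳ (×-distrib-+ _ _ M) ⟨
          M · (k · ⌊ x₁ ⌋ + ⌊ x₂ ⌋) + ⌊ u ⌋         ≈⟨ +-congʳ (×-congʳ M (+-congʳ (⌊·⌋ k x₁))) ⟨
          M · (⌊ k P.· x₁ ⌋ + ⌊ x₂ ⌋) + ⌊ u ⌋       ≈⟨ +-congʳ (⌊·⌋ M (k P.· x₁ P.+ x₂)) ⟨
          ⌊ M P.· (k P.· x₁ P.+ x₂) ⌋ + ⌊ u ⌋       ≈⟨ Mx+u≈ ⟩
          ⌊ suc k P.· x ⌋                           ≈⟨ ⌊·⌋ (suc k) x ⟩
          suc k · ⌊ x ⌋                             ∎)
          (trans x+v≈ (×-distrib-+ y₁ ⌊ x₁ ⌋ M))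

      -- One `x` serves as bound at `i` and at `e + i`; subtracting the two equations leaves
      -- `e x = e X₁ + t`. As `e x` divides `e (Y₁ + X₁)`, `t` divides `e Y₁` and vanishes, so
      -- `x = X₁`. The bound at `i` then reads `X₁ = X₂ + u`, which makes `u` a divisor of `Y₂`,
      -- hence zero.
      squeeze : ∀ i e .{{_ : NonZero e}} {x u t v} →
                (i · X₁ + X₂) + ⌊ u ⌋ ≈ suc i · ⌊ x ⌋ →
                ((e ℕ.+ i) · X₁ + X₂) + (⌊ u ⌋ + ⌊ t ⌋) ≈ suc (e ℕ.+ i) · ⌊ x ⌋ →
                ⌊ x ⌋ + v ≈ Y₁ + X₁ → ⌊ x₁ ⌋ ≈ ⌊ x₂ ⌋
      squeeze i e {x} {u} {t} {v} boundᵢ boundᵢ₊ₑ x+v≈ = ·-cancel torsionFree M (begin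
        X₁           ≈⟨ X₁≈X₂+u ⟩
        X₂ + ⌊ u ⌋   ≈⟨ +-congˡ u≈0 ⟩
        X₂ + 0#      ≈⟨ +-identityʳ X₂ ⟩
        X₂           ∎)
        where
        e·x≈ : e · ⌊ x ⌋ ≈ e · X₁ + ⌊ t ⌋
        e·x≈ = +-cancelʳ (suc i · ⌊ x ⌋) (begin
          e · ⌊ x ⌋ + suc i · ⌊ x ⌋
            ≈⟨ solve 3 (λ ex x ix → ex ⊕ (x ⊕ ix) ⊜ x ⊕ (ex ⊕ ix)) refl (e · ⌊ x ⌋) ⌊ x ⌋ (i · ⌊ x ⌋) ⟩
          ⌊ x ⌋ + (e · ⌊ x ⌋ + i · ⌊ x ⌋)             ≈⟨ +-congˡ (×-homo-+ ⌊ x ⌋ e i) ⟨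
          suc (e ℕ.+ i) · ⌊ x ⌋                       ≈⟨ boundᵢ₊ₑ ⟨
          ((e ℕ.+ i) · X₁ + X₂) + (⌊ u ⌋ + ⌊ t ⌋)     ≈⟨ +-congʳ (+-congʳ (×-homo-+ X₁ e i)) ⟩
          ((e · X₁ + i · X₁) + X₂) + (⌊ u ⌋ + ⌊ t ⌋)
            ≈⟨ solve 5 (λ ex ix x u t → ((ex ⊕ ix) ⊕ x) ⊕ (u ⊕ t) ⊜ (ex ⊕ t) ⊕ ((ix ⊕ x) ⊕ u))
                 refl (e · X₁) (i · X₁) X₂ ⌊ u ⌋ ⌊ t ⌋ ⟩
          (e · X₁ + ⌊ t ⌋) + ((i · X₁ + X₂) + ⌊ u ⌋)  ≈⟨ +-congˡ boundᵢ ⟩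
          (e · X₁ + ⌊ t ⌋) + suc i · ⌊ x ⌋            ∎)

        t≈0 : ⌊ t ⌋ ≈ 0#
        t≈0 = y₁-minimal (e ℕ.* M) {{ℕₚ.m*n≢0 e M}} {t} {e · v} (+-cancelʳ (e · X₁) (begin
          (e ℕ.* M) · y₁ + e · X₁        ≈⟨ +-congʳ (×-assocˡ y₁ e M) ⟨
          e · Y₁ + e · X₁                ≈⟨ ×-distrib-+ Y₁ X₁ e ⟨
          e · (Y₁ + X₁)                  ≈⟨ ×-congʳ e x+v≈ ⟨
          e · (⌊ x ⌋ + v)                ≈⟨ ×-distrib-+ ⌊ x ⌋ v e ⟩
          e · ⌊ x ⌋ + e · v              ≈⟨ +-congʳ e·x≈ ⟩
          (e · X₁ + ⌊ t ⌋) + e · v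
            ≈⟨ solve 3 (λ x t v → (x ⊕ t) ⊕ v ⊜ (t ⊕ v) ⊕ x) refl (e · X₁) ⌊ t ⌋ (e · v) ⟩
          (⌊ t ⌋ + e · v) + e · X₁       ∎))

        x≈X₁ : ⌊ x ⌋ ≈ X₁
        x≈X₁ = ·-cancel torsionFree e (trans e·x≈ (trans (+-congˡ t≈0) (+-identityʳ _)))

        X₁≈X₂+u : X₁ ≈ X₂ + ⌊ u ⌋
        X₁≈X₂+u = +-cancelʳ (i · X₁) (begin
          suc i · X₁                    ≈⟨ ×-congʳ (suc i) x≈X₁ ⟨
          suc i · ⌊ x ⌋                 ≈⟨ boundᵢ ⟨
          (i · X₁ + X₂) + ⌊ u ⌋
            ≈⟨ solve 3 (λ ix x u → (ix ⊕ x) ⊕ u ⊜ (x ⊕ u) ⊕ ix) refl (i · X₁) X₂ ⌊ u ⌋ ⟩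
          (X₂ + ⌊ u ⌋) + i · X₁         ∎)

        u≈0 : ⌊ u ⌋ ≈ 0#
        u≈0 = y₂-minimal M {u} {Y₁} (+-cancelʳ X₂ (begin
          Y₂ + X₂              ≈⟨ Y₁+X₁≈Y₂+X₂ ⟨
          Y₁ + X₁              ≈⟨ +-congˡ X₁≈X₂+u ⟩
          Y₁ + (X₂ + ⌊ u ⌋)    ≈⟨ solve 3 (λ y x u → y ⊕ (x ⊕ u) ⊜ (u ⊕ y) ⊕ x) refl Y₁ X₂ ⌊ u ⌋ ⟩
          (⌊ u ⌋ + Y₁) + X₂    ∎))

      private
        ∣P = _∣ˡ_ P.rawMagma
        ∣Q = _∣ˡ_ rawMagma

        components : ∀ {k} → UpperBound k → P.Carrier × P.Carrier × Carrier
        components (upperBound x u v _ _) = x , u , v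

      -- Part and rest both grow from `i` to `j` while their sum stays `Y₁ + X₁`, so the part is
      -- constant. The growth of the excess is the `t` of `squeeze`.
      compare : ∀ {i j} → i < j → (bᵢ : UpperBound i) (bⱼ : UpperBound j) →
                Pointwise ∣P (Pointwise ∣P ∣Q) (components bᵢ) (components bⱼ) → ⌊ x₁ ⌋ ≈ ⌊ x₂ ⌋
      compare {i} {j} i<j (upperBound x u v boundᵢ x+v≈) (upperBound x′ u′ v′ boundⱼ x′+v′≈)
        ((d , x+d≈) , (t , u+t≈) , (f , v+f≈)) =
        squeeze i (j ∸ i) {{ℕ.>-nonZero (ℕₚ.m<n⇒0<n∸m i<j)}} {x} {u} {t} {v} boundᵢ (begin
          ((j ∸ i ℕ.+ i) · X₁ + X₂) + (⌊ u ⌋ + ⌊ t ⌋)  ≈⟨ +-cong (+-congʳ (×-congˡ j∸i+i≡j)) u+t≈ ⟩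
          (j · X₁ + X₂) + ⌊ u′ ⌋                       ≈⟨ boundⱼ ⟩
          suc j · ⌊ x′ ⌋                               ≈⟨ ×-congʳ (suc j) x+d≈ ⟨
          suc j · (⌊ x ⌋ + ⌊ d ⌋)                      ≈⟨ ×-congʳ (suc j) (+-congˡ d≈0) ⟩
          suc j · (⌊ x ⌋ + 0#)                         ≈⟨ ×-congʳ (suc j) (+-identityʳ ⌊ x ⌋) ⟩
          suc j · ⌊ x ⌋                                ≈⟨ ×-congˡ (≡.cong suc j∸i+i≡j) ⟨
          suc (j ∸ i ℕ.+ i) · ⌊ x ⌋                    ∎)
          x+v≈
        where
        j∸i+i≡j : j ∸ i ℕ.+ i ≡ j
        j∸i+i≡j = ℕₚ.m∸n+n≡m (ℕₚ.<⇒≤ i<j)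

        d≈0 : ⌊ d ⌋ ≈ 0#
        d≈0 = P∩-Q≈0 {d} {f} (+-cancelˡ (⌊ x ⌋ + v) (begin
          (⌊ x ⌋ + v) + (⌊ d ⌋ + f)
            ≈⟨ solve 4 (λ x v d f → (x ⊕ v) ⊕ (d ⊕ f) ⊜ (x ⊕ d) ⊕ (v ⊕ f)) refl ⌊ x ⌋ v ⌊ d ⌋ f ⟩
          (⌊ x ⌋ + ⌊ d ⌋) + (v + f)   ≈⟨ +-cong x+d≈ v+f≈ ⟩
          ⌊ x′ ⌋ + v′                 ≈⟨ x′+v′≈ ⟩
          Y₁ + X₁                     ≈⟨ x+v≈ ⟨
          ⌊ x ⌋ + v                   ≈⟨ +-identityʳ _ ⟨
          (⌊ x ⌋ + v) + 0#            ∎))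

      uniqueness : ⌊ x₁ ⌋ ≈ ⌊ x₂ ⌋
      uniqueness = from-bounds upper-bound
        where
        from-bounds : (∀ k → UpperBound k) → ⌊ x₁ ⌋ ≈ ⌊ x₂ ⌋
        from-bounds bound =
          let g , g-mono , ascending = ×-ascending {R = ∣P} {S = Pointwise ∣P ∣Q} P-ascending
                (×-ascending {R = ∣P} {S = ∣Q} P-ascending Q-ascending) (components ∘ bound)
          in compare (g-mono (ℕ.z<s {0})) (bound (g 0)) (bound (g 1)) (ascending (ℕ.z<s {0}))

  pseudoSaturated⇒unique : PS → UniqueDecompositions
  pseudoSaturated⇒unique (M , M≢0 , pseudoSaturated) = record
    { existence  = λ y → M , M≢0 , existence y
    ; uniqueness = λ {y₁} {y₂} {x₁} {x₂} → uniqueness {y₁} {y₂} {x₁} {x₂}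
    }
    where open PseudoSaturated⇒Unique M {{M≢0}} pseudoSaturated

  -- Unique decompositions imply pseudo-saturation

  minimal-root : ∀ {v} n .{{_ : NonZero n}} → Minimal (n · v) → Minimal v
  minimal-root (suc n) = minimal-∣ 1 (×-homo-1 _)

  -- h belongs to the sum of P and the face of Q generated by v.
  record FacePlusP (v h : Carrier) : Set (c ⊔ ℓ ⊔ p) where
    constructor face+P
    field
      {multiple}        : ℕ
      {{multiple≢0}}    : NonZero multiple
      {face complement} : Carrier
      {part}            : P.Carrier
      face-∣            : multiple · v ≈ face + complement
      splits            : h ≈ face + ⌊ part ⌋

  facePlusP : Carrier → Submonoid Q (c ⊔ ℓ ⊔ p)
  facePlusP v = record
    { Member   = FacePlusP v
    ; respects = λ { x≈y (face+P {part = w} s∣ eq) → face+P {part = w} s∣ (trans (sym x≈y) eq) }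
    ; 0-closed = face+P {multiple = 1} {part = P.0#} (sym (+-identityˡ (1 · v))) (sym (+-identityˡ 0#))
    ; +-closed = +-closed
    }
    where
    +-closed : ∀ {x y} → FacePlusP v x → FacePlusP v y → FacePlusP v (x + y)
    +-closed (face+P {m} {s} {r} {w} s∣ eq) (face+P {n} {s′} {r′} {w′} s′∣ eq′) =
      face+P {multiple = m ℕ.+ n} {{+-nonZero m n}} {part = w P.+ w′}
        (trans (×-homo-+ v m n) (trans (+-cong s∣ s′∣) (interchange s r s′ r′)))
        (trans (+-cong eq eq′) (interchange s ⌊ w ⌋ s′ ⌊ w′ ⌋))

  facePlusP-mono : ∀ {v w h} → _∣ˡ_ rawMagma v w → FacePlusP v h → FacePlusP w h
  facePlusP-mono {v} {w} (q , v+q≈w) (face+P {n} {s} {r} {x} s∣ eq) = face+P {part = x} (begin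
    n · w              ≈⟨ ×-congʳ n v+q≈w ⟨
    n · (v + q)        ≈⟨ ×-distrib-+ v q n ⟩
    n · v + n · q      ≈⟨ +-congʳ s∣ ⟩
    (s + r) + n · q    ≈⟨ assoc _ _ _ ⟩
    s + (r + n · q)    ∎) eq

  open CommonDenominator Q (IsFs.isFinitelyGenerated Q-fs) facePlusP facePlusP-mono

  module Unique⇒PseudoSaturated (unique : UniqueDecompositions) where

    open UniqueDecompositions unique

    -- Multiplying `M y + b = a` by `n` and inserting `n y = v + x` writes one element in two ways
    -- as minimal plus P-part. Uniqueness equates the P-parts and, after cancelling, the minimal
    -- parts. Saturation of P and of Q divides both equations by `n`, which yields the part `d` and
    -- the residue `e`.
    descend : ∀ {v M n y} .{{_ : NonZero M}} .{{_ : NonZero n}} {x} → Minimal v → n · y ≈ v + ⌊ x ⌋ →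
              HasDenominator v M y → Decomposition M y
    descend {v} {M} {n} {y} {x} v-minimal n·y≈v+x
      (difference {a} {b} (face+P {k₁} {s₁} {r₁} {w₁} s₁∣ a≈) (face+P {k₂} {s₂} {r₂} {w₂} s₂∣ b≈) M·y+b≈a) =
      let d , w₁≈w₂+d , n·d≈M·x = P-·-∣-cancel n {w₁} {w₂} {M P.· x} (begin
            n · ⌊ w₁ ⌋                             ≈⟨ n·w₁≈ ⟩
            ⌊ M P.· x ⌋ + ⌊ n P.· w₂ ⌋             ≈⟨ comm _ _ ⟩
            ⌊ n P.· w₂ ⌋ + ⌊ M P.· x ⌋             ≈⟨ +-congʳ (⌊·⌋ n w₂) ⟩
            n · ⌊ w₂ ⌋ + ⌊ M P.· x ⌋               ∎)
          e , s₁≈s₂+e , n·e≈M·v = ·-∣-cancel n n·s₁≈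
      in decomposition {residue = e} {part = d}
           (minimal-root n (minimal-cong (sym n·e≈M·v) (minimal-· M v-minimal)))
           (+-cancelʳ (s₂ + ⌊ w₂ ⌋) (begin
             M · y + (s₂ + ⌊ w₂ ⌋)             ≈⟨ M·y+s₂+w₂≈ ⟩
             s₁ + ⌊ w₁ ⌋                       ≈⟨ +-cong s₁≈s₂+e w₁≈w₂+d ⟩
             (s₂ + e) + (⌊ w₂ ⌋ + ⌊ d ⌋)       ≈⟨ solve 4 (λ s e w d → (s ⊕ e) ⊕ (w ⊕ d) ⊜ (e ⊕ d) ⊕ (s ⊕ w))
                                                    refl s₂ e ⌊ w₂ ⌋ ⌊ d ⌋ ⟩
             (e + ⌊ d ⌋) + (s₂ + ⌊ w₂ ⌋)       ∎))
      where
      M·y+s₂+w₂≈ : M · y + (s₂ + ⌊ w₂ ⌋) ≈ s₁ + ⌊ w₁ ⌋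
      M·y+s₂+w₂≈ = trans (+-congˡ (sym b≈)) (trans M·y+b≈a a≈)

      scaled : n · s₁ + ⌊ n P.· w₁ ⌋ ≈ (M · v + n · s₂) + ⌊ M P.· x P.+ n P.· w₂ ⌋
      scaled = begin
        n · s₁ + ⌊ n P.· w₁ ⌋                        ≈⟨ +-congˡ (⌊·⌋ n w₁) ⟩
        n · s₁ + n · ⌊ w₁ ⌋                          ≈⟨ ×-distrib-+ s₁ ⌊ w₁ ⌋ n ⟨
        n · (s₁ + ⌊ w₁ ⌋)                            ≈⟨ ×-congʳ n M·y+s₂+w₂≈ ⟨
        n · (M · y + (s₂ + ⌊ w₂ ⌋))                  ≈⟨ ×-distrib-+ _ _ n ⟩
        n · M · y + n · (s₂ + ⌊ w₂ ⌋)                ≈⟨ +-cong (·-comm n M y) (×-distrib-+ _ _ n) ⟩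
        M · n · y + (n · s₂ + n · ⌊ w₂ ⌋)            ≈⟨ +-congʳ (×-congʳ M n·y≈v+x) ⟩
        M · (v + ⌊ x ⌋) + (n · s₂ + n · ⌊ w₂ ⌋)      ≈⟨ +-congʳ (×-distrib-+ _ _ M) ⟩
        (M · v + M · ⌊ x ⌋) + (n · s₂ + n · ⌊ w₂ ⌋)  ≈⟨ interchange _ _ _ _ ⟩
        (M · v + n · s₂) + (M · ⌊ x ⌋ + n · ⌊ w₂ ⌋)  ≈⟨ +-congˡ (+-cong (⌊·⌋ M x) (⌊·⌋ n w₂)) ⟨
        (M · v + n · s₂) + ⌊ M P.· x P.+ n P.· w₂ ⌋  ∎

      s₁-minimal : Minimal (n · s₁)
      s₁-minimal = minimal-· n (minimal-∣ k₁ s₁∣ v-minimal)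

      s₂-minimal : Minimal (M · v + n · s₂)
      -- `s₂` lies in the face of `v`, so `M v + n s₂` divides this multiple of `v`.
      s₂-minimal = minimal-∣ (M ℕ.+ n ℕ.* k₂) {{+-nonZero M (n ℕ.* k₂)}} (begin
        (M ℕ.+ n ℕ.* k₂) · v          ≈⟨ ×-homo-+ v M (n ℕ.* k₂) ⟩
        M · v + (n ℕ.* k₂) · v        ≈⟨ +-congˡ (×-assocˡ v n k₂) ⟨
        M · v + n · k₂ · v            ≈⟨ +-congˡ (×-congʳ n s₂∣) ⟩
        M · v + n · (s₂ + r₂)         ≈⟨ +-congˡ (×-distrib-+ s₂ r₂ n) ⟩
        M · v + (n · s₂ + n · r₂)     ≈⟨ assoc _ _ _ ⟨
        (M · v + n · s₂) + n · r₂     ∎) v-minimal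

      n·w₁≈ : n · ⌊ w₁ ⌋ ≈ ⌊ M P.· x ⌋ + ⌊ n P.· w₂ ⌋
      n·w₁≈ = trans (sym (⌊·⌋ n w₁))
        (uniqueness {x₁ = n P.· w₁} {M P.· x P.+ n P.· w₂} s₁-minimal s₂-minimal scaled)

      n·s₁≈ : n · s₁ ≈ n · s₂ + M · v
      n·s₁≈ = +-cancelʳ ⌊ n P.· w₁ ⌋ (begin
        n · s₁ + ⌊ n P.· w₁ ⌋                           ≈⟨ scaled ⟩
        (M · v + n · s₂) + ⌊ M P.· x P.+ n P.· w₂ ⌋     ≈⟨ +-cong (comm _ _) (trans (sym n·w₁≈) (sym (⌊·⌋ n w₁))) ⟩
        (n · s₂ + M · v) + ⌊ n P.· w₁ ⌋                 ∎)

    -- The given decomposition supplies both the face, generated by its residue `v`, and a first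
    -- denominator `n`. The common denominator replaces `n` by an `M` that does not depend on `y`.
    common-decomposition : ∀ {M} .{{_ : NonZero M}} → CommonDenominator M → ∀ y → Decomposition M y
    common-decomposition {M} {{M≢0}} common y =
      let n , n≢0 , decomposition {v} {x} v-minimal n·y≈v+x = existence y
      in descend {{M≢0}} {{n≢0}} {x = x} v-minimal n·y≈v+x
           -- The difference is `(v + x) - 0`: `n y` already lies in the face of `v` plus P.
           (common v n {{n≢0}} y (difference
             (face+P {multiple = 1} {part = x} (trans (×-homo-1 v) (sym (+-identityʳ v))) refl)
             (Submonoid.0-closed (facePlusP v))
             (trans (+-identityʳ _) n·y≈v+x)))

    -- `x′` is the P-part of `M y`. Decomposing also the cofactor `z` gives a second decomposition
    -- of `m n M y`; equating P-parts gives `m n x′ = m M x + M w`, and saturation of P divides by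
    -- `m`.
    pseudo-saturated : ∀ {M} .{{_ : NonZero M}} → (∀ y → Decomposition M y) →
      ∀ n .{{_ : NonZero n}} x y → _∣ˡ_ rawMagma ⌊ x ⌋ (n · y) →
      ∃[ x′ ] _∣ˡ_ P.rawMagma (M P.· x) (n P.· x′) × _∣ˡ_ rawMagma ⌊ x′ ⌋ (M · y)
    pseudo-saturated {M} decompose n x y (z , x+z≈n·y) =
      let m , m≢0 , decomposition {z′} {w} z′-minimal m·z≈z′+w = existence z
          decomposition {y′} {x′} y′-minimal M·y≈y′+x′ = decompose y
          d , eq , _ = P-·-∣-cancel m {{m≢0}} {n P.· x′} {M P.· x} {M P.· w} (begin
            m · ⌊ n P.· x′ ⌋              ≈⟨ ⌊·⌋ m (n P.· x′) ⟨
            ⌊ m P.· n P.· x′ ⌋            ≈⟨ uniqueness {x₁ = m P.· n P.· x′} {M P.· (m P.· x P.+ w)}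
                                               (minimal-· m {{m≢0}} (minimal-· n y′-minimal)) (minimal-· M z′-minimal)
                                               (compare {m} {y′} {x′} {z′} {w} m·z≈z′+w M·y≈y′+x′) ⟩
            ⌊ M P.· (m P.· x P.+ w) ⌋     ≈⟨ P.×-distrib-+ (m P.· x) w M ⟩
            ⌊ M P.· m P.· x ⌋ + ⌊ M P.· w ⌋  ≈⟨ +-congʳ (P.·-comm M m x) ⟩
            ⌊ m P.· M P.· x ⌋ + ⌊ M P.· w ⌋  ≈⟨ +-congʳ (⌊·⌋ m (M P.· x)) ⟩
            m · ⌊ M P.· x ⌋ + ⌊ M P.· w ⌋    ∎)
      in x′ , (d , sym eq) , (y′ , trans (comm ⌊ x′ ⌋ y′) (sym M·y≈y′+x′))
      where
      compare : ∀ {m y′ x′ z′ w} → m · z ≈ z′ + ⌊ w ⌋ → M · y ≈ y′ + ⌊ x′ ⌋ →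
        m · n · y′ + ⌊ m P.· n P.· x′ ⌋ ≈ M · z′ + ⌊ M P.· (m P.· x P.+ w) ⌋
      compare {m} {y′} {x′} {z′} {w} m·z≈z′+w M·y≈y′+x′ = begin
        m · n · y′ + ⌊ m P.· n P.· x′ ⌋        ≈⟨ +-congˡ (trans (⌊·⌋ m (n P.· x′)) (×-congʳ m (⌊·⌋ n x′))) ⟩
        m · n · y′ + m · n · ⌊ x′ ⌋            ≈⟨ ×-distrib-+ _ _ m ⟨
        m · (n · y′ + n · ⌊ x′ ⌋)              ≈⟨ ×-congʳ m (×-distrib-+ _ _ n) ⟨
        m · n · (y′ + ⌊ x′ ⌋)                  ≈⟨ ×-congʳ m (×-congʳ n M·y≈y′+x′) ⟨
        m · n · M · y                          ≈⟨ ×-congʳ m (·-comm n M y) ⟩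
        m · M · n · y                          ≈⟨ ·-comm m M (n · y) ⟩
        M · m · n · y                          ≈⟨ ×-congʳ M (×-congʳ m x+z≈n·y) ⟨
        M · m · (⌊ x ⌋ + z)                    ≈⟨ ×-congʳ M (×-distrib-+ _ _ m) ⟩
        M · (m · ⌊ x ⌋ + m · z)                ≈⟨ ×-congʳ M (+-cong (sym (⌊·⌋ m x)) m·z≈z′+w) ⟩
        M · (⌊ m P.· x ⌋ + (z′ + ⌊ w ⌋))       ≈⟨ ×-congʳ M (solve 3 (λ x z w → x ⊕ (z ⊕ w) ⊜ z ⊕ (x ⊕ w))
                                                    refl ⌊ m P.· x ⌋ z′ ⌊ w ⌋) ⟩
        M · (z′ + ⌊ m P.· x P.+ w ⌋)           ≈⟨ ×-distrib-+ _ _ M ⟩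
        M · z′ + M · ⌊ m P.· x P.+ w ⌋         ≈⟨ +-congˡ (⌊·⌋ M (m P.· x P.+ w)) ⟨
        M · z′ + ⌊ M P.· (m P.· x P.+ w) ⌋     ∎

  unique⇒pseudoSaturated : UniqueDecompositions → PS
  unique⇒pseudoSaturated unique =
    let M , M≢0 , common = commonDenominator em
    in M , M≢0 , pseudo-saturated {{M≢0}} (common-decomposition {{M≢0}} common)
    where open Unique⇒PseudoSaturated unique

  -- Translation to fractions in the rationalized group

  private
    module V = AbelianGroup (Q ᵍᵖ ⊗ℚ) renaming (_∙_ to infixl 6 _+_)

  open Colimit Mᵍᵖ.commutativeMonoid using (witness)
  open Subtraction (Q ᵍᵖ ⊗ℚ)

  ι-cong : ∀ {x y} → x ≈ y → ι x ≈ᵍᵖ ι y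
  ι-cong x≈y = witness 0# (+-congʳ (+-congʳ x≈y))

  ·ᵍᵖ-ι : ∀ n x → n ·ᵍᵖ ι x ≈ᵍᵖ ι (n · x)
  ·ᵍᵖ-ι n x = ≡.subst (_≈ᵍᵖ ι (n · x)) (≡.sym (·ᵍᵖ-⊖ n x 0#))
    (witness 0# (+-congʳ (+-congˡ (sym (·-zeroʳ n)))))

  /-cong : ∀ {x y m n} .{{_ : NonZero m}} .{{_ : NonZero n}} →
           n · x ≈ m · y → ι x / m V.≈ ι y / n
  /-cong {x} {y} {m} {n} eq = witness n m (ℕₚ.*-comm n m)
    (Mᵍᵖ.trans (·ᵍᵖ-ι n x) (Mᵍᵖ.trans (ι-cong eq) (Mᵍᵖ.sym (·ᵍᵖ-ι m y))))

  -- Cross-multiplication needs cancellation of the factor `i` that brings both fractions to a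
  -- common index; torsion-freeness and integrality provide it.
  /-injective : ∀ {x y m n} .{{_ : NonZero m}} .{{_ : NonZero n}} →
                ι x / m V.≈ ι y / n → n · x ≈ m · y
  /-injective {x} {y} {m} {n} (witness i j i*m≡j*n ix≈jy) = ·-cancel torsionFree i (begin
    i · n · x        ≈⟨ ·-comm i n x ⟩
    n · i · x        ≈⟨ ×-congʳ n (IsSaturated.isIntegral (IsFs.isSaturated Q-fs)
                          (Mᵍᵖ.trans (Mᵍᵖ.sym (·ᵍᵖ-ι i x)) (Mᵍᵖ.trans ix≈jy (·ᵍᵖ-ι j y)))) ⟩
    n · j · y        ≈⟨ ·-comm n j y ⟩
    j · n · y        ≈⟨ ×-assocˡ y j n ⟩
    (j ℕ.* n) · y    ≈⟨ ×-congˡ i*m≡j*n ⟨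
    (i ℕ.* m) · y    ≈⟨ ×-assocˡ y i m ⟨
    i · m · y        ∎)

  /-+ : ∀ {x y} m n .{{_ : NonZero m}} .{{_ : NonZero n}} →
        ι x / m V.+ ι y / n V.≈ _/_ (ι (n · x + m · y)) (m ℕ.* n) {{ℕₚ.m*n≢0 m n}}
  /-+ {x} {y} m n = witness 1 1 ≡.refl (Mᵍᵖ.∙-congʳ (Mᵍᵖ.trans
    (Mᵍᵖ.∙-cong (·ᵍᵖ-ι n x) (·ᵍᵖ-ι m y))
    (witness 0# (+-congʳ (+-congˡ (sym (+-identityˡ 0#)))))))

  split : ∀ {x y z m n} .{{_ : NonZero m}} .{{_ : NonZero n}} → n · x ≈ m · (y + z) →
          ι x / m V.≈ ι y / n V.+ ι z / n
  split {x} {y} {z} {m} {n} eq = V.trans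
    (/-cong {{_}} {{ℕₚ.m*n≢0 n n}} (begin
      (n ℕ.* n) · x          ≈⟨ ×-assocˡ x n n ⟨
      n · n · x              ≈⟨ ×-congʳ n eq ⟩
      n · m · (y + z)        ≈⟨ ·-comm n m _ ⟩
      m · n · (y + z)        ≈⟨ ×-congʳ m (×-distrib-+ y z n) ⟩
      m · (n · y + n · z)    ∎))
    (V.sym (/-+ n n))

  unsplit : ∀ {x y z k m n} .{{_ : NonZero k}} .{{_ : NonZero m}} .{{_ : NonZero n}} →
            ι x / k V.≈ ι y / m V.+ ι z / n → (m ℕ.* n) · x ≈ k · (n · y + m · z)
  unsplit {m = m} {n} eq = /-injective {{_}} {{ℕₚ.m*n≢0 m n}} (V.trans eq (/-+ m n))

  -- With `x = p / l` and `q / k - x = r / m`, clearing denominators gives `l m q = k m p + k l r`.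
  -- So `k m p` is a divisor of a multiple of `q` and must vanish.
  minimal⇒ : ∀ {q k} .{{_ : NonZero k}} → Minimal q →
             ∀ x → x ∈ Pℚ≥0 P → ¬ (x V.≈ V.ε) → ¬ ((ι q / k V.- x) ∈ Qℚ≥0 P)
  minimal⇒ {q} {k} q-minimal x (p / l , p/l≈x) x≉0 (r / m , r/m≈) = x≉0 (V.trans
    {x} {ι ⌊ p ⌋ / l} {V.ε} (V.sym {ι ⌊ p ⌋ / l} {x} p/l≈x)
    (/-cong (trans (×-homo-1 ⌊ p ⌋) (trans p≈0 (sym (·-zeroʳ l))))))
    where
    q/k≈ : ι q / k V.≈ ι ⌊ p ⌋ / l V.+ ι r / m
    q/k≈ = V.trans {ι q / k} {x V.+ (ι q / k V.- x)} {ι ⌊ p ⌋ / l V.+ ι r / m}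
      (V.sym {x V.+ (ι q / k V.- x)} {ι q / k} (x∙[y-x]≈y x (ι q / k)))
      (V.sym {ι ⌊ p ⌋ / l V.+ ι r / m} {x V.+ (ι q / k V.- x)}
        (V.∙-cong {ι ⌊ p ⌋ / l} {x} {ι r / m} {ι q / k V.- x} p/l≈x r/m≈))

    p≈0 : ⌊ p ⌋ ≈ 0#
    p≈0 = ·-cancel-0 (k ℕ.* m) {{ℕₚ.m*n≢0 k m}} (trans (sym (⌊·⌋ (k ℕ.* m) p))
      (q-minimal (l ℕ.* m) {{ℕₚ.m*n≢0 l m}} {(k ℕ.* m) P.· p} {k · l · r} (begin
        (l ℕ.* m) · q                        ≈⟨ unsplit q/k≈ ⟩
        k · (m · ⌊ p ⌋ + l · r)              ≈⟨ ×-distrib-+ _ _ k ⟩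
        k · m · ⌊ p ⌋ + k · l · r            ≈⟨ +-congʳ (×-assocˡ ⌊ p ⌋ k m) ⟩
        (k ℕ.* m) · ⌊ p ⌋ + k · l · r        ≈⟨ +-congʳ (⌊·⌋ (k ℕ.* m) p) ⟨
        ⌊ (k ℕ.* m) P.· p ⌋ + k · l · r      ∎)))

  -- Dividing `n q = p + z` by `n k` gives `q / k - p / (n k) = z / (n k)`, so `p / (n k)` can be
  -- subtracted from `y′` and is therefore zero. The element `y′` is kept apart from `q / k` because
  -- a decomposition only supplies a fraction equal to it.
  minimal⇐ : ∀ {q k y′} .{{_ : NonZero k}} → ι q / k V.≈ y′ →
             (∀ x → x ∈ Pℚ≥0 P → ¬ (x V.≈ V.ε) → ¬ ((y′ V.- x) ∈ Qℚ≥0 P)) → Minimal q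
  minimal⇐ {q} {k} {y′} q/k≈y′ y′-minimal n {p} {z} n·q≈p+z =
    ≈0-stable λ p≉0 → y′-minimal p/nk (p / (n ℕ.* k) , V.refl {p/nk})
      (λ p/nk≈0 → p≉0 (trans (sym (×-homo-1 ⌊ p ⌋)) (trans (/-injective p/nk≈0) (·-zeroʳ (n ℕ.* k)))))
      (z / (n ℕ.* k) , z/nk≈)
    where
    instance
      nk≢0 : NonZero (n ℕ.* k)
      nk≢0 = ℕₚ.m*n≢0 n k

    p/nk z/nk : V.Carrier
    p/nk = ι ⌊ p ⌋ / (n ℕ.* k)
    z/nk = ι z / (n ℕ.* k)

    n·k·q≈ : (n ℕ.* k) · q ≈ k · (⌊ p ⌋ + z)
    n·k·q≈ = begin
      (n ℕ.* k) · q      ≈⟨ ×-assocˡ q n k ⟨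
      n · k · q          ≈⟨ ·-comm n k q ⟩
      k · n · q          ≈⟨ ×-congʳ k n·q≈p+z ⟩
      k · (⌊ p ⌋ + z)    ∎

    z/nk≈ : z/nk V.≈ y′ V.- p/nk
    z/nk≈ = V.sym {y′ V.- p/nk} {z/nk} (y≈x∙z⇒y-x≈z y′ p/nk z/nk
      (V.trans {y′} {ι q / k} {p/nk V.+ z/nk} (V.sym {ι q / k} {y′} q/k≈y′) (split {n = n ℕ.* k} n·k·q≈)))

  isMinimalDecomposition : ∀ {q p m n y} .{{_ : NonZero m}} .{{_ : NonZero n}} → Minimal q →
    y V.≈ ι q / m V.+ ι ⌊ p ⌋ / n → IsMinimalDecomposition P y (ι q / m , ι ⌊ p ⌋ / n)
  isMinimalDecomposition {q} {p} {m} {n} q-minimal y≈ = record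
    { decomposes = y≈
    ; y′∈Qℚ≥0    = q / m , V.refl {ι q / m}
    ; x′∈Pℚ≥0    = p / n , V.refl {ι ⌊ p ⌋ / n}
    ; minimal    = minimal⇒ q-minimal
    }

  HasUniqueMinimalDecompositions : Set (c ⊔ ℓ ⊔ p)
  HasUniqueMinimalDecompositions =
    ∀ y → y ∈ Qℚ≥0 P → ∃! (Pointwise V._≈_ V._≈_) (IsMinimalDecomposition P y)

  -- The cleared form of comparing `q / n = y₁ / (m n) + x₁ / (m n)` with `q / n = y₂ / k + x₂ / l`.
  -- Both are brought to the element `k l m q`, where uniqueness in Q equates the P-parts.
  compare-decompositions : ∀ {q n m y₁ y₂ x₁ x₂ k l}
    .{{_ : NonZero n}} .{{_ : NonZero m}} .{{_ : NonZero k}} .{{_ : NonZero l}} →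
    UniqueDecompositions → Minimal y₁ → m · q ≈ y₁ + ⌊ x₁ ⌋ →
    Minimal y₂ → (k ℕ.* l) · q ≈ n · (l · y₂ + k · ⌊ x₂ ⌋) →
    k · y₁ ≈ (m ℕ.* n) · y₂ × l · ⌊ x₁ ⌋ ≈ (m ℕ.* n) · ⌊ x₂ ⌋
  compare-decompositions {q} {n} {m} {y₁} {y₂} {x₁} {x₂} {k} {l} unique y₁-minimal m·q≈ y₂-minimal kl·q≈ =
    ·-cancel torsionFree l l·ky₁≈ , ·-cancel torsionFree k k·lx₁≈
    where
    instance
      mn≢0 : NonZero (m ℕ.* n)
      mn≢0 = ℕₚ.m*n≢0 m n

    scaled : (k · l · y₁) + (k · l · ⌊ x₁ ⌋) ≈ ((m ℕ.* n) · l · y₂) + ((m ℕ.* n) · k · ⌊ x₂ ⌋)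
    scaled = begin
      k · l · y₁ + k · l · ⌊ x₁ ⌋                        ≈⟨ ×-distrib-+ _ _ k ⟨
      k · (l · y₁ + l · ⌊ x₁ ⌋)                          ≈⟨ ×-congʳ k (×-distrib-+ _ _ l) ⟨
      k · l · (y₁ + ⌊ x₁ ⌋)                              ≈⟨ ×-congʳ k (×-congʳ l m·q≈) ⟨
      k · l · m · q                                      ≈⟨ ×-assocˡ (m · q) k l ⟩
      (k ℕ.* l) · m · q                                  ≈⟨ ·-comm (k ℕ.* l) m q ⟩
      m · (k ℕ.* l) · q                                  ≈⟨ ×-congʳ m kl·q≈ ⟩
      m · n · (l · y₂ + k · ⌊ x₂ ⌋)                      ≈⟨ ×-assocˡ _ m n ⟩
      (m ℕ.* n) · (l · y₂ + k · ⌊ x₂ ⌋)                  ≈⟨ ×-distrib-+ _ _ (m ℕ.* n) ⟩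
      (m ℕ.* n) · l · y₂ + (m ℕ.* n) · k · ⌊ x₂ ⌋        ∎

    ⌊·-·⌋ : ∀ i j x → ⌊ i P.· j P.· x ⌋ ≈ i · j · ⌊ x ⌋
    ⌊·-·⌋ i j x = trans (⌊·⌋ i (j P.· x)) (×-congʳ i (⌊·⌋ j x))

    k·l·x₁≈ : k · l · ⌊ x₁ ⌋ ≈ (m ℕ.* n) · k · ⌊ x₂ ⌋
    k·l·x₁≈ = begin
      k · l · ⌊ x₁ ⌋                     ≈⟨ ⌊·-·⌋ k l x₁ ⟨
      ⌊ k P.· l P.· x₁ ⌋                 ≈⟨ UniqueDecompositions.uniqueness unique
        {x₁ = k P.· l P.· x₁} {(m ℕ.* n) P.· k P.· x₂}
        (minimal-· k (minimal-· l y₁-minimal)) (minimal-· (m ℕ.* n) (minimal-· l y₂-minimal))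
        (trans (+-congˡ (⌊·-·⌋ k l x₁)) (trans scaled (+-congˡ (sym (⌊·-·⌋ (m ℕ.* n) k x₂))))) ⟩
      ⌊ (m ℕ.* n) P.· k P.· x₂ ⌋         ≈⟨ ⌊·-·⌋ (m ℕ.* n) k x₂ ⟩
      (m ℕ.* n) · k · ⌊ x₂ ⌋             ∎

    k·lx₁≈ : k · l · ⌊ x₁ ⌋ ≈ k · (m ℕ.* n) · ⌊ x₂ ⌋
    k·lx₁≈ = trans k·l·x₁≈ (·-comm (m ℕ.* n) k ⌊ x₂ ⌋)

    l·ky₁≈ : l · k · y₁ ≈ l · (m ℕ.* n) · y₂
    l·ky₁≈ = trans (·-comm l k y₁) (trans
      (+-cancelʳ ((m ℕ.* n) · k · ⌊ x₂ ⌋) (trans (+-congˡ (sym k·l·x₁≈)) scaled))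
      (·-comm (m ℕ.* n) l y₂))

  unique⇒ : UniqueDecompositions → HasUniqueMinimalDecompositions
  unique⇒ unique y (q / n , q/n≈y) =
    let m , m≢0 , d = UniqueDecompositions.existence unique q in from m {{m≢0}} d
    where
    from : ∀ m .{{_ : NonZero m}} → Decomposition m q →
           ∃! (Pointwise V._≈_ V._≈_) (IsMinimalDecomposition P y)
    from m (decomposition {y₁} {x₁} y₁-minimal m·q≈) =
        -- The element is `q / n`, and `m q = y₁ + x₁`.
        (ι y₁ / (m ℕ.* n) , ι ⌊ x₁ ⌋ / (m ℕ.* n))
      , isMinimalDecomposition {p = x₁} y₁-minimal
          (V.trans {y} {ι q / n} (V.sym {ι q / n} {y} q/n≈y) (split {n = m ℕ.* n} (begin
            (m ℕ.* n) · q        ≈⟨ ×-assocˡ q m n ⟨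
            m · n · q            ≈⟨ ·-comm m n q ⟩
            n · m · q            ≈⟨ ×-congʳ n m·q≈ ⟩
            n · (y₁ + ⌊ x₁ ⌋)    ∎)))
      , λ {z} → compare {z}
      where
      instance
        mn≢0 : NonZero (m ℕ.* n)
        mn≢0 = ℕₚ.m*n≢0 m n

      compare : ∀ {z} → IsMinimalDecomposition P y z →
                Pointwise V._≈_ V._≈_ (ι y₁ / (m ℕ.* n) , ι ⌊ x₁ ⌋ / (m ℕ.* n)) z
      compare {y′ , x′} z-minimal with IsMinimalDecomposition.y′∈Qℚ≥0 z-minimal
                                     | IsMinimalDecomposition.x′∈Pℚ≥0 z-minimal
      ... | y₂ / k , y₂/k≈y′ | x₂ / l , x₂/l≈x′ =
        let eq₁ , eq₂ = compare-decompositions {x₁ = x₁} {x₂} unique y₁-minimal m·q≈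
              (minimal⇐ {y′ = y′} y₂/k≈y′ (IsMinimalDecomposition.minimal z-minimal))
              (unsplit {q} {y₂} {⌊ x₂ ⌋} q/n≈)
        in V.trans {ι y₁ / (m ℕ.* n)} {ι y₂ / k} {y′} (/-cong eq₁) y₂/k≈y′
         , V.trans {ι ⌊ x₁ ⌋ / (m ℕ.* n)} {ι ⌊ x₂ ⌋ / l} {x′} (/-cong eq₂) x₂/l≈x′
        where
        q/n≈ : ι q / n V.≈ ι y₂ / k V.+ ι ⌊ x₂ ⌋ / l
        q/n≈ = V.trans {ι q / n} {y} {ι y₂ / k V.+ ι ⌊ x₂ ⌋ / l} q/n≈y
          (V.trans {y} {y′ V.+ x′} {ι y₂ / k V.+ ι ⌊ x₂ ⌋ / l} (IsMinimalDecomposition.decomposes z-minimal)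
            (V.sym {ι y₂ / k V.+ ι ⌊ x₂ ⌋ / l} {y′ V.+ x′}
              (V.∙-cong {ι y₂ / k} {y′} {ι ⌊ x₂ ⌋ / l} {x′} y₂/k≈y′ x₂/l≈x′)))

  unique⇐ : HasUniqueMinimalDecompositions → UniqueDecompositions
  unique⇐ hasUnique = record
    { existence  = λ y → existence y (proj₁ (proj₁ (d y))) (proj₂ (proj₁ (d y))) (proj₁ (proj₂ (d y)))
    ; uniqueness = λ {y₁} {y₂} {x₁} {x₂} → uniqueness {y₁} {y₂} {x₁} {x₂}
    }
    where
    d : ∀ y → ∃! (Pointwise V._≈_ V._≈_) (IsMinimalDecomposition P (ι y / 1))
    d y = hasUnique (ι y / 1) (y / 1 , V.refl {ι y / 1})

    existence : ∀ y y′ x′ → IsMinimalDecomposition P (ι y / 1) (y′ , x′) →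
                ∃[ n ] NonZero n × Decomposition n y
    existence y y′ x′ isMin with IsMinimalDecomposition.y′∈Qℚ≥0 isMin | IsMinimalDecomposition.x′∈Pℚ≥0 isMin
    ... | q / k , q/k≈y′ | x / l , x/l≈x′ = k ℕ.* l , ℕₚ.m*n≢0 k l ,
      -- These come from clearing denominators in `y = q / k + x / l`.
      decomposition {residue = l · q} {part = k P.· x}
        (minimal-· l (minimal⇐ {y′ = y′} q/k≈y′ (IsMinimalDecomposition.minimal isMin))) (begin
          (k ℕ.* l) · y                    ≈⟨ unsplit {y} {q} {⌊ x ⌋} y≈ ⟩
          1 · (l · q + k · ⌊ x ⌋)          ≈⟨ ×-homo-1 _ ⟩
          l · q + k · ⌊ x ⌋                ≈⟨ +-congˡ (⌊·⌋ k x) ⟨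
          l · q + ⌊ k P.· x ⌋              ∎)
      where
      y≈ : ι y / 1 V.≈ ι q / k V.+ ι ⌊ x ⌋ / l
      y≈ = V.trans {ι y / 1} {y′ V.+ x′} {ι q / k V.+ ι ⌊ x ⌋ / l} (IsMinimalDecomposition.decomposes isMin)
        (V.sym {ι q / k V.+ ι ⌊ x ⌋ / l} {y′ V.+ x′}
          (V.∙-cong {ι q / k} {y′} {ι ⌊ x ⌋ / l} {x′} q/k≈y′ x/l≈x′))

    uniqueness : ∀ {y₁ y₂ x₁ x₂} → Minimal y₁ → Minimal y₂ →
                 y₁ + ⌊ x₁ ⌋ ≈ y₂ + ⌊ x₂ ⌋ → ⌊ x₁ ⌋ ≈ ⌊ x₂ ⌋
    uniqueness {y₁} {y₂} {x₁} {x₂} y₁-minimal y₂-minimal eq =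
      let (_ , x′) , _ , unique = d (y₁ + ⌊ x₁ ⌋)
          x′≈x₁ = proj₂ (unique (isMinimalDecomposition {y₁} {x₁} {1} {1} y₁-minimal (split {m = 1} {1} refl)))
          x′≈x₂ = proj₂ (unique (isMinimalDecomposition {y₂} {x₂} {1} {1} y₂-minimal (split {m = 1} {1} (×-congʳ 1 eq))))
      in trans (sym (×-homo-1 _)) (trans
           (/-injective {⌊ x₁ ⌋} {⌊ x₂ ⌋} {1} {1}
             (V.trans {ι ⌊ x₁ ⌋ / 1} {x′} {ι ⌊ x₂ ⌋ / 1} (V.sym {x′} {ι ⌊ x₁ ⌋ / 1} x′≈x₁) x′≈x₂))
           (×-homo-1 _))

theorem1p3 : ∀ {c ℓ p} → ExcludedMiddle (c ⊔ ℓ ⊔ p) →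
    (Q : CommutativeMonoid c ℓ) (P : Submonoid Q p) →
    TorsionFree Q → IsFs Q →
    IsToric (Submonoid.commutativeMonoid P) →
    IntersectsNegTrivially P →
    let open AbelianGroup (Q ᵍᵖ ⊗ℚ) using (_≈_) in
    PseudoSaturated (Submonoid.commutativeMonoid P) Q (Submonoid.inclusion P)
    ⇔
    (∀ y → y ∈ Qℚ≥0 P → ∃! (Pointwise _≈_ _≈_) (IsMinimalDecomposition P y))
theorem1p3 em Q P torsionFree Q-fs P-toric P∩-Q =
  mk⇔ (unique⇒ ∘ pseudoSaturated⇒unique) (unique⇒pseudoSaturated ∘ unique⇐)
  where open Decompositions em Q P torsionFree Q-fs P-toric P∩-Q
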